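{- Let $\mathcal{R}$ be a representable signature. On well-typed representable terms over $\mathcal{R}$, the reduction $\to_{\mathsf{rep}} = \to_\beta \cup \to_\eta$ is confluent and strongly normalizing.
   Context: A representable signature consists of a set $\mathcal{A}$ of atoms and a multigraph $\mathcal{R}$ whose nodes (types) are generated by $a ::= o \in \mathcal{A} \mid (a_1 \otimes \cdots \otimes a_k)$ for $k \in \mathbb{N}$, with sets $\mathcal{R}(a_1,\dots,a_n;b)$ of multiarrows. Representable terms: $s,t ::= x \mid \langle s_1,\dots,s_k\rangle \mid s[x_1^{a_1},\dots,x_k^{a_k} := t] \mid f(s_1,\dots,s_n)$; in $s[\vec{x} := t]$ the $x_i$ are bound in $s$; terms up to renaming of bound variables. Typing rules: $x:a \vdash x:a$; if $f \in \mathcal{R}(a_1,\dots,a_n;b)$ and $\gamma_i \vdash s_i : a_i$ then $\gamma_1,\dots,\gamma_n \vdash f(s_1,\dots,s_n) : b$; if $\gamma_i \vdash s_i : a_i$ then $\gamma_1,\dots,\gamma_k \vdash \langle s_1,\dots,s_k\rangle : (a_1\otimes\cdots\otimes a_k)$; if $\gamma \vdash t : (a_1 \otimes\cdots\otimes a_k)$ and $\delta, x_1:a_1,\dots,x_k:a_k, \delta' \vdash s : b$ then $\delta,\gamma,\delta' \vdash s[x_1^{a_1},\dots,x_k^{a_k} := t] : b$; combined contexts are disjoint lists of distinct variables. Contexts with one hole: $\mathtt{C} ::= [\cdot] \mid \langle s_1,\dots,\mathtt{C},\dots,s_k\rangle \mid \mathtt{C}[\vec{x}:=t] \mid s[\vec{x}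 := \mathtt{C}] \mid f(s_1,\dots,\mathtt{C},\dots,s_n)$; $\mathtt{E}$ has the same grammar except that the clause $s[\vec{x} := \mathtt{E}]$ requires $\mathtt{E} \neq [\cdot]$; $\mathtt{L} ::= [\cdot] \mid \mathtt{L}[\vec{x} := t]$. $\mathsf{LT}$ is the set of terms $\mathtt{L}[\langle s_1,\dots,s_k\rangle]$. $\beta$: $s[x_1,\dots,x_k := \mathtt{L}[\langle t_1,\dots,t_k\rangle]] \to_\beta \mathtt{L}[s\{t_1/x_1,\dots,t_k/x_k\}]$ (capture-avoiding substitution), closed under $\mathtt{C}$-contexts. $\eta$: $s \to_\eta \langle x_1,\dots,x_k\rangle[x_1^{a_1},\dots,x_k^{a_k} := s]$ whenever $s$ has type $(a_1\otimes\cdots\otimes a_k)$, the $x_i$ are fresh and $s \notin \mathsf{LT}$; closed under $\mathtt{E}$-contexts. -}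

module Defs where

open import Data.List using (List; []; _∷_; _++_; [_])
open import Data.List.Properties using (++-assoc; ++-identityʳ)
open import Data.Product using (Σ; ∃; _×_; _,_)
open import Data.Sum using (_⊎_)
open import Data.Empty using (⊥)
open import Data.Unit using (⊤)
open import Relation.Nullary using (¬_)
open import Relation.Binary.PropositionalEquality
  using (_≡_; refl; sym; trans; cong; subst)

data Ty (A : Set) : Set where
  atom : A → Ty A
  ⊗    : List (Ty A) → Ty A

-- A representable signature: atoms A and a multigraph ℛ whose nodes are
-- the types, with sets of multiarrows ℛ (a₁ ∷ … ∷ aₙ ∷ []) b.

module Rep (A : Set) (ℛ : List (Ty A) → Ty A → Set) where

  Ctx : Set
  Ctx = List (Ty A)

  private
    variable
      a b c ah : Ty A
      as bs : List (Ty A)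
      Γ Γ₀ Γ₁ Γ₂ Γh Δ γ : Ctx

  -- Well-typed representable terms, represented intrinsically (as typing
  -- derivations; variables are positions of the ordered linear context).
  --   var          :  x : a ⊢ x : a
  --   tup ts       :  ⟨ s₁ , … , sₖ ⟩
  --   letin δ δ' s t  :  s [ x₁ … xₖ := t ]  where s is typed in
  --                   δ , x₁:a₁ … xₖ:aₖ , δ'  and the result in δ , γ , δ'
  --   app f ts     :  f (s₁ , … , sₙ)
  -- Tms Γ as is a list of terms s₁ … sₖ of types as whose contexts
  -- concatenate (in order) to Γ.

  data Tm : Ctx → Ty A → Set
  data Tms : Ctx → List (Ty A) → Set

  data Tm where
    var   : Tm [ a ] a
    tup   : Tms Γ as → Tm Γ (⊗ as)
    letin : (δ δ' : Ctx) → Tm (δ ++ as ++ δ') b → Tm γ (⊗ as) →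
            Tm (δ ++ γ ++ δ') b
    app   : ℛ as b → Tms Γ as → Tm Γ b

  data Tms where
    []  : Tms [] []
    _∷_ : Tm Γ₁ a → Tms Γ₂ as → Tms (Γ₁ ++ Γ₂) (a ∷ as)

  infixr 5 _∷_ _++ₜ_

  _++ₜ_ : Tms Γ₁ as → Tms Γ₂ bs → Tms (Γ₁ ++ Γ₂) (as ++ bs)
  [] ++ₜ ys = ys
  _++ₜ_ {Γ₂ = Γ₂} (_∷_ {Γ₁ = G₁} {Γ₂ = G₂} t ts) ys =
    subst (λ G → Tms G _) (sym (++-assoc G₁ G₂ Γ₂)) (t ∷ (ts ++ₜ ys))

  ids : (as : List (Ty A)) → Tms as as
  ids []       = []
  ids (a ∷ as) = var ∷ ids as

  split : (Γ₁ : Ctx) → Tms Δ (Γ₁ ++ Γ₂) →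
          Σ Ctx λ Δ₁ → Σ Ctx λ Δ₂ → (Δ ≡ Δ₁ ++ Δ₂) × Tms Δ₁ Γ₁ × Tms Δ₂ Γ₂
  split {Δ = Δ} [] σ = [] , Δ , refl , [] , σ
  split (a ∷ Γ₁) (_∷_ {Γ₁ = G} t σ) with split Γ₁ σ
  ... | D₁ , D₂ , eq , σ₁ , σ₂ =
    G ++ D₁ , D₂ , trans (cong (G ++_) eq) (sym (++-assoc G D₁ D₂)) ,
    t ∷ σ₁ , σ₂

  sub  : Tm Γ b → Tms Δ Γ → Tm Δ b
  subs : Tms Γ as → Tms Δ Γ → Tms Δ as

  sub var (_∷_ {Γ₁ = G} t []) = subst (λ D → Tm D _) (sym (++-identityʳ G)) t
  sub (tup ts) σ = tup (subs ts σ)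
  sub (app f ts) σ = app f (subs ts σ)
  sub (letin {as = as} {γ = γ} δ δ' s t) σ with split δ σ
  ... | Δ₁ , Δ₂₃ , eq , σ₁ , σ₂₃ with split γ σ₂₃
  ... | Δ₂ , Δ₃ , eq' , σ₂ , σ₃ =
    subst (λ D → Tm D _) (sym (trans eq (cong (Δ₁ ++_) eq')))
      (letin Δ₁ Δ₃ (sub s (σ₁ ++ₜ ids as ++ₜ σ₃)) (sub t σ₂))

  subs [] [] = []
  subs (_∷_ {Γ₁ = G} t ts) σ with split G σ
  ... | Δ₁ , Δ₂ , eq , σ₁ , σ₂ =
    subst (λ D → Tms D _) (sym eq) (sub t σ₁ ∷ subs ts σ₂)

  -- Let-stacks  L ::= [·] | L[x⃗ := t]   (Stk Γ₀ Γ : hole in context Γ₀,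
  -- whole in context Γ; the type of the hole is arbitrary)

  data Stk : Ctx → Ctx → Set where
    [·]  : Stk Γ Γ
    lay  : (ε ε' : Ctx) → Stk Γ₀ (ε ++ as ++ ε') → Tm γ (⊗ as) →
           Stk Γ₀ (ε ++ γ ++ ε')

  plugL : Stk Γ₀ Γ → Tm Γ₀ c → Tm Γ c
  plugL [·] u = u
  plugL (lay ε ε' L t) u = letin ε ε' (plugL L u) t

  reassoc : (δ ε X ε' δ' : Ctx) →
            δ ++ (ε ++ X ++ ε') ++ δ' ≡ (δ ++ ε) ++ X ++ (ε' ++ δ')
  reassoc δ ε X ε' δ' = sym (trans (++-assoc δ ε (X ++ ε' ++ δ'))
    (cong (δ ++_) (trans (cong (ε ++_) (sym (++-assoc X ε' δ')))
                         (sym (++-assoc ε (X ++ ε') δ')))))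

  frame : (δ δ' : Ctx) → Stk Γ₀ Γ → Stk (δ ++ Γ₀ ++ δ') (δ ++ Γ ++ δ')
  frame δ δ' [·] = [·]
  frame δ δ' (lay {as = as} {γ = γ} ε ε' L t) =
    subst (Stk _) (sym (reassoc δ ε γ ε' δ'))
      (lay (δ ++ ε) (ε' ++ δ')
        (subst (Stk _) (reassoc δ ε as ε' δ') (frame δ δ' L)) t)

  InLT : Tm Γ (⊗ as) → Set
  InLT {Γ = Γ} {as = as} s =
    Σ Ctx λ Γ₀ → Σ (Stk Γ₀ Γ) λ L → Σ (Tms Γ₀ as) λ ts → s ≡ plugL L (tup ts)

  data BetaRoot : Tm Γ b → Tm Γ b → Set where
    β : (δ δ' : Ctx) (s : Tm (δ ++ as ++ δ') b) (L : Stk Γ₀ γ)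
        (ts : Tms Γ₀ as) →
        BetaRoot (letin δ δ' s (plugL L (tup ts)))
                 (plugL (frame δ δ' L) (sub s (ids δ ++ₜ ts ++ₜ ids δ')))

  ηexp : Tm Γ (⊗ as) → Tm Γ (⊗ as)
  ηexp {Γ = Γ} {as = as} s =
    subst (λ G → Tm G (⊗ as)) (++-identityʳ Γ)
      (letin [] []
        (subst (λ G → Tm G (⊗ as)) (sym (++-identityʳ as)) (tup (ids as)))
        s)

  data EtaRoot : Tm Γ b → Tm Γ b → Set where
    η : (s : Tm Γ (⊗ as)) → ¬ InLT s → EtaRoot s (ηexp s)

  data Hole (Γh : Ctx) (ah : Ty A) : Ctx → Ty A → Set where
    [·]      : Hole Γh ah Γh ah
    tupH     : Tms Γ₁ as → Hole Γh ah Γ a → Tms Γ₂ bs →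
               Hole Γh ah (Γ₁ ++ Γ ++ Γ₂) (⊗ (as ++ a ∷ bs))
    letBodyH : (δ δ' : Ctx) → Hole Γh ah (δ ++ as ++ δ') b →
               Tm γ (⊗ as) → Hole Γh ah (δ ++ γ ++ δ') b
    letArgH  : (δ δ' : Ctx) → Tm (δ ++ as ++ δ') b →
               Hole Γh ah γ (⊗ as) → Hole Γh ah (δ ++ γ ++ δ') b
    appH     : ℛ (as ++ a ∷ bs) b → Tms Γ₁ as → Hole Γh ah Γ a →
               Tms Γ₂ bs → Hole Γh ah (Γ₁ ++ Γ ++ Γ₂) b

  plug : Hole Γh ah Γ a → Tm Γh ah → Tm Γ a
  plug [·] u = u
  plug (tupH ts C ts') u = tup (ts ++ₜ plug C u ∷ ts')
  plug (letBodyH δ δ' C t) u = letin δ δ' (plug C u) t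
  plug (letArgH δ δ' s C) u = letin δ δ' s (plug C u)
  plug (appH f ts C ts') u = app f (ts ++ₜ plug C u ∷ ts')

  NotHole : Hole Γh ah Γ a → Set
  NotHole [·] = ⊥
  NotHole _   = ⊤

  data IsE {Γh ah} : Hole Γh ah Γ a → Set where
    [·]      : IsE ([·] {Γh} {ah})
    tupH     : {ts : Tms Γ₁ as} {C : Hole Γh ah Γ a} {ts' : Tms Γ₂ bs} →
               IsE C → IsE (tupH ts C ts')
    letBodyH : {δ δ' : Ctx} {C : Hole Γh ah (δ ++ as ++ δ') b}
               {t : Tm γ (⊗ as)} → IsE C → IsE (letBodyH δ δ' C t)
    letArgH  : {δ δ' : Ctx} {s : Tm (δ ++ as ++ δ') b}
               {C : Hole Γh ah γ (⊗ as)} →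
               IsE C → NotHole C → IsE (letArgH δ δ' s C)
    appH     : {f : ℛ (as ++ a ∷ bs) b} {ts : Tms Γ₁ as}
               {C : Hole Γh ah Γ a} {ts' : Tms Γ₂ bs} →
               IsE C → IsE (appH f ts C ts')

  infix 4 _⟶β_ _⟶η_ _⟶rep_

  data _⟶β_ : Tm Γ a → Tm Γ a → Set where
    ctx : (C : Hole Γh ah Γ a) {l r : Tm Γh ah} →
          BetaRoot l r → plug C l ⟶β plug C r

  data _⟶η_ : Tm Γ a → Tm Γ a → Set where
    ctx : (C : Hole Γh ah Γ a) → IsE C → {l r : Tm Γh ah} →
          EtaRoot l r → plug C l ⟶η plug C r

  _⟶rep_ : Tm Γ a → Tm Γ a → Set
  s ⟶rep t = (s ⟶β t) ⊎ (s ⟶η t)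

{-# OPTIONS --safe #-}
module Submission where

-- Terms are evaluated to long normal forms.  A term of tensor type evaluates
-- to a stack of lets with neutral arguments over a tuple, variables and
-- applications being η-expanded at once.  Both β and η preserve the normal
-- form read back from the value, every term either reduces or is literally
-- its own normal form, and so confluence follows from strong normalization.
--
-- For the latter, values also count the let layers m that a term may
-- release when it is the argument of a let, where a let whose argument has
-- no layer counts for one.  A let costs 1.  A term outside LT also pays,
-- with k = 2 + (weight of its components), (m + 1) k in a position that
-- admits η, but only m k as the argument of a let.  Thus η pays for the let
-- and for the variables that it introduces; below a let in argument
-- position, η is paid for by the layer of that let.  Substitution does not
-- increase values or costs, so β gains the let that it removes.

open import Defs
open import Algebra.Properties.CommutativeSemigroup using (interchange; xy∙z≈xz∙y)
open import Data.Bool using (Bool; true; false)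
open import Data.Empty using (⊥-elim)
open import Data.List using (List; []; _∷_; _++_; [_]; map)
open import Data.List.Properties
  using (++-assoc; ++-identityʳ; map-++; map-∘; map-cong; map-id; ∷-injective)
open import Data.List.Relation.Binary.Pointwise using (Pointwise; []; _∷_; ++⁺)
open import Data.Nat using (ℕ; zero; suc; pred; _+_; _*_; _≤_; _<_; z≤n; s≤s)
open import Data.Nat.Induction using (<-wellFounded)
open import Data.Nat.Properties
open import Data.Nat.Tactic.RingSolver using (solve-∀)
open import Data.Product using (Σ; ∃; _×_; _,_; proj₁; proj₂)
open import Data.Sum using (_⊎_; inj₁; inj₂)
open import Data.Unit using (tt)
open import Function using (flip; case_of_)
open import Induction.WellFounded using (Acc; acc; module Subrelation)
open import Relation.Binary.Construct.Closure.ReflexiveTransitive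
  using (Star; _◅_; _◅◅_) renaming (ε to done)
import Relation.Binary.Construct.On as On
open import Relation.Binary.PropositionalEquality
  using (_≡_; refl; sym; trans; cong; cong₂; subst; subst₂; module ≡-Reasoning)
open import Relation.Binary.Rewriting using (Confluent; StronglyNormalizing)
open import Relation.Nullary using (¬_)

module Normalization (A : Set) (ℛ : List (Ty A) → Ty A → Set) where

  open Rep A ℛ

  private
    variable
      a b ah : Ty A
      as bs : List (Ty A)
      Γ Γ₀ Γ₁ Γ₂ Γh Δ γ δ δ' : Ctx

  -- Codes of terms.

  -- As for letin in Tm, the two contexts say where the let is inserted; they
  -- are not determined by the other data when it binds no variable and its
  -- argument is closed.
  data Raw : Set where
    var   : Ty A → Raw
    tup   : List Raw → Raw
    letin : Ctx → Ctx → Raw → Raw → Raw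
    app   : ℛ as b → List Raw → Raw

  -- Normal forms are compared through untyped codes: a read-back value then needs no typing
  -- derivation, and no equality has to be transported along context equations.
  code  : Tm Γ a → Raw
  codes : Tms Γ as → List Raw
  code (var {a = a})     = var a
  code (tup ts)          = tup (codes ts)
  code (letin δ δ' s t)  = letin δ δ' (code s) (code t)
  code (app f ts)        = app f (codes ts)
  codes []               = []
  codes (t ∷ ts)         = code t ∷ codes ts

  -- Values and environments.

  -- (δ , δ' , n) stands for letin δ δ' [·] n with n neutral; in a list the
  -- outermost layer comes first.
  Layer : Set
  Layer = Ctx × Ctx × Raw

  -- Each component is an `Entry`, spelled out because that type depends on `Core`. Its context is
  -- the one that the component consumes; the contexts of let layers are recomputed from these.
  -- Evaluation produces `ne` only at atomic types.
  data Core : Set where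
    tup : List (Ctx × ℕ × List Layer × Core) → Core
    ne  : Raw → Core

  Val : Set
  Val = ℕ × List Layer × Core

  Entry : Set
  Entry = Ctx × Val

  Env : Set
  Env = List Entry

  core : Val → Core
  core (_ , _ , c) = c

  comps : Core → Env
  comps (tup ρ) = ρ
  -- A default value: in a typed environment the core at a tensor type is a tuple.
  comps (ne _)  = []

  -- In an environment m is stored as max m 1 - 1, since a variable stays
  -- outside LT until a term is substituted for it, and so counts for at
  -- least one layer.
  store load : Val → Val
  store (m , v) = pred m , v
  load (m , v)  = suc m , v

  ctxOf : Env → Ctx
  ctxOf []            = []
  ctxOf ((Δ , _) ∷ ρ) = Δ ++ ctxOf ρ

  -- η-expansion of a neutral code: at a tensor type it becomes the argument of one let, over the
  -- tuple of the bound variables, which are reflected in turn.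
  reflect : Ty A → Raw → Val
  idEnv   : Ctx → Env
  reflect (atom _) r = 1 , [] , ne r
  reflect (⊗ as)   r = 1 , [ [] , [] , r ] , tup (idEnv as)
  idEnv []       = []
  idEnv (a ∷ as) = ([ a ] , store (reflect a (var a))) ∷ idEnv as

  quoteC : Core → Raw
  quotes : Env → List Raw
  wrap   : List Layer → Raw → Raw
  wrap []                  r = r
  wrap ((δ , δ' , n) ∷ ls) r = letin δ δ' (wrap ls r) n
  quoteC (tup ρ) = tup (quotes ρ)
  quoteC (ne r)  = r
  quotes []                      = []
  quotes ((_ , _ , ls , c) ∷ ρ)  = wrap ls (quoteC c) ∷ quotes ρ

  quoteV : Val → Raw
  quoteV (_ , ls , c) = wrap ls (quoteC c)

  shift : Ctx → Ctx → Layer → Layer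
  shift δ δ' (ε , ε' , r) = δ ++ ε , ε' ++ δ' , r

  -- suc (pred m) is max m 1.
  bind : Ctx → Ctx → Val → Val → Val
  bind δ δ' (m , ls , _) (m' , ls' , c) =
    suc (pred m) + m' , map (shift δ δ') ls ++ ls' , c

  -- Only the length of the context is used. Environments that are too short are truncated, so that
  -- evaluation is total without a typing hypothesis.
  upto from : Ctx → Env → Env
  upto []      ρ       = []
  upto (_ ∷ _) []      = []
  upto (_ ∷ Γ) (e ∷ ρ) = e ∷ upto Γ ρ
  from []      ρ       = ρ
  from (_ ∷ _) []      = []
  from (_ ∷ Γ) (_ ∷ ρ) = from Γ ρ

  -- Evaluation.

  eval  : Tm Γ a → Env → Val
  evals : Tms Γ as → Env → Env
  -- Junk: a well-typed environment for var has one entry.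
  eval var []            = 0 , [] , tup []
  eval var ((_ , v) ∷ _) = load v
  eval (tup ts) ρ        = 0 , [] , tup (evals ts ρ)
  eval (app {b = b} f ts) ρ = reflect b (app f (quotes (evals ts ρ)))
  -- The body sees only the components of the tuple; the layers above the tuple move out of the let.
  eval (letin {γ = γ} δ δ' s t) ρ =
    bind (ctxOf ρ₁) (ctxOf ρ₃) v (eval s (ρ₁ ++ comps (core v) ++ ρ₃))
    where
    ρ₁ = upto δ ρ
    ρ₃ = from γ (from δ ρ)
    v  = eval t (upto γ (from δ ρ))
  evals [] ρ = []
  evals (_∷_ {Γ₁ = G} t ts) ρ =
    (ctxOf (upto G ρ) , store (eval t (upto G ρ))) ∷ evals ts (from G ρ)

  -- Costs.

  -- A Boolean form of `InLT`, extended to all types so that costs can branch on it.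
  isLT : Tm Γ a → Bool
  isLT var             = false
  isLT (tup _)         = true
  isLT (letin _ _ s _) = isLT s
  isLT (app _ _)       = false

  -- An entry weighs the penalty of the variable bound to it: its number of
  -- layers is suc m.
  weights : Env → ℕ
  weight  : Core → ℕ
  weights []                     = 0
  weights ((_ , m , _ , c) ∷ ρ)  = suc (suc m) * (2 + weight c) + weights ρ
  weight (tup ρ) = weights ρ
  weight (ne _)  = 0

  unlessLT : Bool → ℕ → ℕ
  unlessLT true  _ = 0
  unlessLT false n = n

  penalty penaltyArg : Bool → Val → ℕ
  penalty    b (m , _ , c) = unlessLT b (suc m * (2 + weight c))
  penaltyArg b (m , _ , c) = unlessLT b (m * (2 + weight c))

  -- The penalty of the root depends on the position of the term, so `cost` omits it; `costE` adds
  -- it for positions that admit η, `costA` for the argument of a let.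
  cost  : Tm Γ a → Env → ℕ
  costE : Tm Γ a → Env → ℕ
  costA : Tm Γ a → Env → ℕ
  costs : Tms Γ as → Env → ℕ
  cost var        ρ = 0
  cost (tup ts)   ρ = costs ts ρ
  cost (app f ts) ρ = costs ts ρ
  cost (letin {γ = γ} δ δ' s t) ρ =
    suc (cost s (ρ₁ ++ comps (core (eval t ρ₂)) ++ ρ₃) + costA t ρ₂)
    where
    ρ₁ = upto δ ρ
    ρ₂ = upto γ (from δ ρ)
    ρ₃ = from γ (from δ ρ)
  costE t ρ = cost t ρ + penalty (isLT t) (eval t ρ)
  costA t ρ = cost t ρ + penaltyArg (isLT t) (eval t ρ)
  costs [] ρ = 0
  costs (_∷_ {Γ₁ = G} t ts) ρ = costE t (upto G ρ) + costs ts (from G ρ)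

  -- Domination of values

  infix 4 _≲C_ _≲E_ _≲_ _≲*_

  -- Only layer counts may grow; contexts, layers and shape must agree. Hence domination fixes the
  -- read-back exactly while costs are monotone in it.
  data _≲C_ : Core → Core → Set
  _≲E_ : Entry → Entry → Set
  (Δ , m , ls , c) ≲E (Δ' , m' , ls' , c') = Δ ≡ Δ' × m ≤ m' × ls ≡ ls' × c ≲C c'

  data _≲C_ where
    tup : ∀ {ρ ρ'} → Pointwise _≲E_ ρ ρ' → tup ρ ≲C tup ρ'
    ne  : ∀ {r} → ne r ≲C ne r

  _≲_ : Val → Val → Set
  (m , ls , c) ≲ (m' , ls' , c') = m ≤ m' × ls ≡ ls' × c ≲C c'

  _≲*_ : Env → Env → Set
  _≲*_ = Pointwise _≲E_

  ≲C-refl : ∀ {c} → c ≲C c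
  ≲*-refl : ∀ {ρ} → ρ ≲* ρ
  ≲C-refl {tup ρ} = tup ≲*-refl
  ≲C-refl {ne r}  = ne
  ≲*-refl {[]}    = []
  ≲*-refl {(_ , _ , _ , c) ∷ ρ} = (refl , ≤-refl , refl , ≲C-refl) ∷ ≲*-refl

  ≲-refl : ∀ {v} → v ≲ v
  ≲-refl = ≤-refl , refl , ≲C-refl

  ≲-reflexive : ∀ {v w} → v ≡ w → v ≲ w
  ≲-reflexive refl = ≲-refl

  ≲*-reflexive : ∀ {ρ ρ'} → ρ ≡ ρ' → ρ ≲* ρ'
  ≲*-reflexive refl = ≲*-refl

  ≲C-trans : ∀ {c d e} → c ≲C d → d ≲C e → c ≲C e
  ≲*-trans : ∀ {ρ ρ' ρ''} → ρ ≲* ρ' → ρ' ≲* ρ'' → ρ ≲* ρ''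
  ≲C-trans (tup p) (tup q) = tup (≲*-trans p q)
  ≲C-trans ne ne = ne
  ≲*-trans [] [] = []
  ≲*-trans ((refl , p , refl , q) ∷ ps) ((refl , p' , refl , q') ∷ ps') =
    (refl , ≤-trans p p' , refl , ≲C-trans q q') ∷ ≲*-trans ps ps'

  ≲-trans : ∀ {u v w} → u ≲ v → v ≲ w → u ≲ w
  ≲-trans (p , refl , q) (p' , refl , q') = ≤-trans p p' , refl , ≲C-trans q q'

  ≲*-comps : ∀ {c d} → c ≲C d → comps c ≲* comps d
  ≲*-comps (tup p) = p
  ≲*-comps ne      = []

  ≲*-upto : ∀ Γ {ρ ρ'} → ρ ≲* ρ' → upto Γ ρ ≲* upto Γ ρ'
  ≲*-upto []      p        = []
  ≲*-upto (_ ∷ Γ) []       = []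
  ≲*-upto (_ ∷ Γ) (p ∷ ps) = p ∷ ≲*-upto Γ ps

  ≲*-from : ∀ Γ {ρ ρ'} → ρ ≲* ρ' → from Γ ρ ≲* from Γ ρ'
  ≲*-from []      p        = p
  ≲*-from (_ ∷ Γ) []       = []
  ≲*-from (_ ∷ Γ) (p ∷ ps) = ≲*-from Γ ps

  ≲*-middle : ∀ ρ₁ ρ₃ {c d} → c ≲C d → ρ₁ ++ comps c ++ ρ₃ ≲* ρ₁ ++ comps d ++ ρ₃
  ≲*-middle ρ₁ ρ₃ p = ++⁺ (≲*-refl {ρ₁}) (++⁺ (≲*-comps p) (≲*-refl {ρ₃}))

  ≲*-ctxOf : ∀ {ρ ρ'} → ρ ≲* ρ' → ctxOf ρ ≡ ctxOf ρ'
  ≲*-ctxOf []                = refl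
  ≲*-ctxOf ((refl , _) ∷ ps) = cong (_ ++_) (≲*-ctxOf ps)

  ≲C-quote : ∀ {c d} → c ≲C d → quoteC c ≡ quoteC d
  ≲*-quote : ∀ {ρ ρ'} → ρ ≲* ρ' → quotes ρ ≡ quotes ρ'
  ≲C-quote (tup p) = cong tup (≲*-quote p)
  ≲C-quote ne      = refl
  ≲*-quote []      = refl
  ≲*-quote ((_ , _ , refl , q) ∷ ps) =
    cong₂ _∷_ (cong (wrap _) (≲C-quote q)) (≲*-quote ps)

  ≲-quote : ∀ {v w} → v ≲ w → quoteV v ≡ quoteV w
  ≲-quote (_ , refl , q) = cong (wrap _) (≲C-quote q)

  ≲-bind : ∀ {δ ε δ' ε' u v u' v'} → δ ≡ ε → δ' ≡ ε' → u ≲ u' → v ≲ v' →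
           bind δ δ' u v ≲ bind ε ε' u' v'
  ≲-bind refl refl (p , refl , _) (p' , refl , q) =
    +-mono-≤ (s≤s (pred-mono-≤ p)) p' , refl , q

  ≲-store : ∀ {Δ Δ' v w} → Δ ≡ Δ' → v ≲ w → (Δ , store v) ≲E (Δ' , store w)
  ≲-store refl (p , q) = refl , pred-mono-≤ p , q

  eval-mono  : (t : Tm Γ a) → ∀ {ρ ρ'} → ρ ≲* ρ' → eval t ρ ≲ eval t ρ'
  evals-mono : (ts : Tms Γ as) → ∀ {ρ ρ'} → ρ ≲* ρ' → evals ts ρ ≲* evals ts ρ'
  eval-mono var []                           = ≲-refl
  eval-mono var ((_ , p , q) ∷ _)            = s≤s p , q
  eval-mono (tup ts) p                       = ≤-refl , refl , tup (evals-mono ts p)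
  eval-mono (app {b = b} f ts) p             =
    -- The arguments enter the value only through their read-back, which domination fixes.
    ≲-reflexive (cong (λ rs → reflect b (app f rs)) (≲*-quote (evals-mono ts p)))
  eval-mono (letin {γ = γ} δ δ' s t) p =
    ≲-bind (≲*-ctxOf p₁) (≲*-ctxOf p₃) q
      (eval-mono s (++⁺ p₁ (++⁺ (≲*-comps (proj₂ (proj₂ q))) p₃)))
    where
    p₁ = ≲*-upto δ p
    p₃ = ≲*-from γ (≲*-from δ p)
    q  = eval-mono t (≲*-upto γ (≲*-from δ p))
  evals-mono [] p = []
  evals-mono (_∷_ {Γ₁ = G} t ts) p =
    ≲-store (≲*-ctxOf p₁) (eval-mono t p₁) ∷ evals-mono ts (≲*-from G p)
    where p₁ = ≲*-upto G p

  weight-mono  : ∀ {c d} → c ≲C d → weight c ≤ weight d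
  weights-mono : ∀ {ρ ρ'} → ρ ≲* ρ' → weights ρ ≤ weights ρ'
  weight-mono (tup p) = weights-mono p
  weight-mono ne      = z≤n
  weights-mono []     = z≤n
  weights-mono ((_ , p , _ , q) ∷ ps) =
    +-mono-≤ (*-mono-≤ (s≤s (s≤s p)) (+-monoʳ-≤ 2 (weight-mono q))) (weights-mono ps)

  -- The implication has this direction because steps and substitutions may bring a term into LT but
  -- never out of it, which can only remove a penalty.
  unlessLT-mono : ∀ {b b' m n} → (b ≡ true → b' ≡ true) → m ≤ n →
                  unlessLT b' m ≤ unlessLT b n
  unlessLT-mono {true}  {true}  _ _ = z≤n
  unlessLT-mono {true}  {false} f _ with () ← f refl
  unlessLT-mono {false} {true}  _ _ = z≤n
  unlessLT-mono {false} {false} _ p = p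

  penalty-mono : ∀ {b b' v w} → (b ≡ true → b' ≡ true) → v ≲ w →
                 penalty b' v ≤ penalty b w
  penalty-mono f (p , _ , q) =
    unlessLT-mono f (*-mono-≤ (s≤s p) (+-monoʳ-≤ 2 (weight-mono q)))

  penaltyArg-mono : ∀ {b b' v w} → (b ≡ true → b' ≡ true) → v ≲ w →
                    penaltyArg b' v ≤ penaltyArg b w
  penaltyArg-mono f (p , _ , q) =
    unlessLT-mono f (*-mono-≤ p (+-monoʳ-≤ 2 (weight-mono q)))

  cost-mono  : (t : Tm Γ a) → ∀ {ρ ρ'} → ρ ≲* ρ' → cost t ρ ≤ cost t ρ'
  costE-mono : (t : Tm Γ a) → ∀ {ρ ρ'} → ρ ≲* ρ' → costE t ρ ≤ costE t ρ'
  costA-mono : (t : Tm Γ a) → ∀ {ρ ρ'} → ρ ≲* ρ' → costA t ρ ≤ costA t ρ'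
  costs-mono : (ts : Tms Γ as) → ∀ {ρ ρ'} → ρ ≲* ρ' → costs ts ρ ≤ costs ts ρ'
  cost-mono var p        = z≤n
  cost-mono (tup ts) p   = costs-mono ts p
  cost-mono (app f ts) p = costs-mono ts p
  cost-mono (letin {γ = γ} δ δ' s t) p =
    s≤s (+-mono-≤ (cost-mono s (++⁺ p₁ (++⁺ (≲*-comps (proj₂ (proj₂ (eval-mono t p₂)))) p₃)))
                  (costA-mono t p₂))
    where
    p₁ = ≲*-upto δ p
    p₂ = ≲*-upto γ (≲*-from δ p)
    p₃ = ≲*-from γ (≲*-from δ p)
  costE-mono t p = +-mono-≤ (cost-mono t p) (penalty-mono {isLT t} (λ e → e) (eval-mono t p))
  costA-mono t p = +-mono-≤ (cost-mono t p) (penaltyArg-mono {isLT t} (λ e → e) (eval-mono t p))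
  costs-mono [] p = z≤n
  costs-mono (_∷_ {Γ₁ = G} t ts) p =
    +-mono-≤ (costE-mono t (≲*-upto G p)) (costs-mono ts (≲*-from G p))

  -- Typed environments

  -- Records just that a core of tensor type is a tuple with the right number of components, which
  -- makes `upto` and `from` cut environments at the intended places.
  data TypedC : Ty A → Core → Set
  TypedE : Ty A → Entry → Set
  TypedE a (_ , v) = TypedC a (core v)

  data TypedC where
    atom : ∀ {o c} → TypedC (atom o) c
    tup  : ∀ {ρ} → Pointwise TypedE as ρ → TypedC (⊗ as) (tup ρ)

  Typed : Ctx → Env → Set
  Typed = Pointwise TypedE

  typed-comps : ∀ {c} → TypedC (⊗ as) c → Typed as (comps c)
  typed-comps (tup p) = p

  typed-upto : ∀ Γ₁ {Γ₂ ρ} → Typed (Γ₁ ++ Γ₂) ρ → Typed Γ₁ (upto Γ₁ ρ)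
  typed-upto []       p        = []
  typed-upto (_ ∷ Γ₁) (p ∷ ps) = p ∷ typed-upto Γ₁ ps

  typed-from : ∀ Γ₁ {Γ₂ ρ} → Typed (Γ₁ ++ Γ₂) ρ → Typed Γ₂ (from Γ₁ ρ)
  typed-from []       p        = p
  typed-from (_ ∷ Γ₁) (_ ∷ ps) = typed-from Γ₁ ps

  upto-++ : ∀ Γ₁ {Γ₂ ρ ρ'} → Typed (Γ₁ ++ Γ₂) ρ → upto Γ₁ (ρ ++ ρ') ≡ upto Γ₁ ρ
  upto-++ []       p        = refl
  upto-++ (_ ∷ Γ₁) (_ ∷ ps) = cong (_ ∷_) (upto-++ Γ₁ ps)

  from-++ : ∀ Γ₁ {Γ₂ ρ ρ'} → Typed (Γ₁ ++ Γ₂) ρ →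
            from Γ₁ (ρ ++ ρ') ≡ from Γ₁ ρ ++ ρ'
  from-++ []       p        = refl
  from-++ (_ ∷ Γ₁) (_ ∷ ps) = from-++ Γ₁ ps

  upto-all : ∀ {Γ ρ} → Typed Γ ρ → ∀ {ρ'} → upto Γ (ρ ++ ρ') ≡ ρ
  upto-all []       = refl
  upto-all (_ ∷ ps) = cong (_ ∷_) (upto-all ps)

  from-all : ∀ {Γ ρ} → Typed Γ ρ → ∀ {ρ'} → from Γ (ρ ++ ρ') ≡ ρ'
  from-all []       = refl
  from-all (_ ∷ ps) = from-all ps

  upto-upto : ∀ Γ₁ Γ₂ (ρ : Env) → upto Γ₁ (upto (Γ₁ ++ Γ₂) ρ) ≡ upto Γ₁ ρ
  upto-upto []       Γ₂ ρ       = refl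
  upto-upto (_ ∷ Γ₁) Γ₂ []      = refl
  upto-upto (_ ∷ Γ₁) Γ₂ (e ∷ ρ) = cong (e ∷_) (upto-upto Γ₁ Γ₂ ρ)

  upto++from : ∀ Γ ρ → upto Γ ρ ++ from Γ ρ ≡ ρ
  upto++from []      ρ       = refl
  upto++from (_ ∷ Γ) []      = refl
  upto++from (_ ∷ Γ) (e ∷ ρ) = cong (e ∷_) (upto++from Γ ρ)

  from-upto : ∀ Γ₁ Γ₂ (ρ : Env) →
              from Γ₁ (upto (Γ₁ ++ Γ₂) ρ) ≡ upto Γ₂ (from Γ₁ ρ)
  from-upto []       Γ₂      ρ       = refl
  from-upto (_ ∷ Γ₁) []      []      = refl
  from-upto (_ ∷ Γ₁) (_ ∷ _) []      = refl
  from-upto (_ ∷ Γ₁) Γ₂      (e ∷ ρ) = from-upto Γ₁ Γ₂ ρ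

  from-from : ∀ Γ₁ Γ₂ (ρ : Env) → from (Γ₁ ++ Γ₂) ρ ≡ from Γ₂ (from Γ₁ ρ)
  from-from []       Γ₂      ρ       = refl
  from-from (_ ∷ Γ₁) []      []      = refl
  from-from (_ ∷ Γ₁) (_ ∷ _) []      = refl
  from-from (_ ∷ Γ₁) Γ₂      (e ∷ ρ) = from-from Γ₁ Γ₂ ρ

  ctxOf-++ : ∀ ρ ρ' → ctxOf (ρ ++ ρ') ≡ ctxOf ρ ++ ctxOf ρ'
  ctxOf-++ []            ρ' = refl
  ctxOf-++ ((Δ , _) ∷ ρ) ρ' =
    trans (cong (Δ ++_) (ctxOf-++ ρ ρ')) (sym (++-assoc Δ (ctxOf ρ) (ctxOf ρ')))

  reflect-typed : ∀ a {r} → TypedC a (core (reflect a r))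
  idEnv-typed   : ∀ Γ → Typed Γ (idEnv Γ)
  reflect-typed (atom _) = atom
  reflect-typed (⊗ as)   = tup (idEnv-typed as)
  idEnv-typed []         = []
  idEnv-typed (a ∷ Γ)    = reflect-typed a ∷ idEnv-typed Γ

  eval-typed  : (t : Tm Γ a) → ∀ {ρ} → Typed Γ ρ → TypedC a (core (eval t ρ))
  evals-typed : (ts : Tms Γ as) → ∀ {ρ} → Typed Γ ρ → Typed as (evals ts ρ)
  eval-typed var (p ∷ [])           = p
  eval-typed (tup ts) p             = tup (evals-typed ts p)
  eval-typed (app {b = b} f ts) p   = reflect-typed b
  eval-typed (letin {γ = γ} δ δ' s t) p =
    eval-typed s (++⁺ (typed-upto δ p)
      (++⁺ (typed-comps (eval-typed t (typed-upto γ (typed-from δ p))))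
           (typed-from γ (typed-from δ p))))
  evals-typed [] []                       = []
  evals-typed (_∷_ {Γ₁ = G} t ts) p =
    eval-typed t (typed-upto G p) ∷ evals-typed ts (typed-from G p)

  -- Lets later arguments supply their own decomposition of the environment in place of the
  -- truncations made by `eval`.
  eval-letin : ∀ (s : Tm (δ ++ as ++ δ') b) (t : Tm γ (⊗ as)) {ρ ρ₁ ρ₂ ρ₃} →
    Typed δ ρ₁ → Typed γ ρ₂ → ρ ≡ ρ₁ ++ ρ₂ ++ ρ₃ →
    eval (letin δ δ' s t) ρ ≡
    bind (ctxOf ρ₁) (ctxOf ρ₃) (eval t ρ₂)
         (eval s (ρ₁ ++ comps (core (eval t ρ₂)) ++ ρ₃))
  eval-letin s t {ρ₁ = ρ₁} {ρ₂} {ρ₃} p₁ p₂ refl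
    rewrite upto-all p₁ {ρ₂ ++ ρ₃} | from-all p₁ {ρ₂ ++ ρ₃}
          | upto-all p₂ {ρ₃} | from-all p₂ {ρ₃} = refl

  cost-letin : ∀ (s : Tm (δ ++ as ++ δ') b) (t : Tm γ (⊗ as)) {ρ ρ₁ ρ₂ ρ₃} →
    Typed δ ρ₁ → Typed γ ρ₂ → ρ ≡ ρ₁ ++ ρ₂ ++ ρ₃ →
    cost (letin δ δ' s t) ρ ≡
    suc (cost s (ρ₁ ++ comps (core (eval t ρ₂)) ++ ρ₃) + costA t ρ₂)
  cost-letin s t {ρ₁ = ρ₁} {ρ₂} {ρ₃} p₁ p₂ refl
    rewrite upto-all p₁ {ρ₂ ++ ρ₃} | from-all p₁ {ρ₂ ++ ρ₃}
          | upto-all p₂ {ρ₃} | from-all p₂ {ρ₃} = refl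

  -- Evaluation of substitutions

  eval-subst : ∀ {G D} (e : G ≡ D) (t : Tm G a) ρ →
               eval (subst (λ D → Tm D a) e t) ρ ≡ eval t ρ
  eval-subst refl t ρ = refl

  evals-subst : ∀ {G D} (e : G ≡ D) (ts : Tms G as) ρ →
                evals (subst (λ D → Tms D as) e ts) ρ ≡ evals ts ρ
  evals-subst refl t ρ = refl

  cost-subst : ∀ {G D} (e : G ≡ D) (t : Tm G a) ρ →
               cost (subst (λ D → Tm D a) e t) ρ ≡ cost t ρ
  cost-subst refl t ρ = refl

  isLT-subst : ∀ {G D} (e : G ≡ D) (t : Tm G a) →
               isLT (subst (λ D → Tm D a) e t) ≡ isLT t
  isLT-subst refl t = refl

  -- Unlike `costs`, this omits root penalties: a substituted term takes the place of a variable,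
  -- and that variable already pays the penalty due there.
  costSum : Tms Γ as → Env → ℕ
  costSum [] ρ = 0
  costSum (_∷_ {Γ₁ = G} t ts) ρ = cost t (upto G ρ) + costSum ts (from G ρ)

  costSum-subst : ∀ {G D} (e : G ≡ D) (ts : Tms G as) ρ →
                  costSum (subst (λ D → Tms D as) e ts) ρ ≡ costSum ts ρ
  costSum-subst refl t ρ = refl

  evals-++ₜ : (ts : Tms Γ₁ as) (us : Tms Γ₂ bs) → ∀ {ρ₁ ρ₂} → Typed Γ₁ ρ₁ →
              evals (ts ++ₜ us) (ρ₁ ++ ρ₂) ≡ evals ts ρ₁ ++ evals us ρ₂
  evals-++ₜ [] us [] = refl
  evals-++ₜ {Γ₂ = Γ₂} (_∷_ {Γ₁ = G₁} {Γ₂ = G₂} t ts) us {ρ₁} {ρ₂} p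
    rewrite evals-subst (sym (++-assoc G₁ G₂ Γ₂)) (t ∷ (ts ++ₜ us)) (ρ₁ ++ ρ₂)
          | upto-++ G₁ {ρ' = ρ₂} p | from-++ G₁ {ρ' = ρ₂} p =
    cong (_ ∷_) (evals-++ₜ ts us (typed-from G₁ p))

  costSum-++ₜ : (ts : Tms Γ₁ as) (us : Tms Γ₂ bs) → ∀ {ρ₁ ρ₂} → Typed Γ₁ ρ₁ →
                costSum (ts ++ₜ us) (ρ₁ ++ ρ₂) ≡ costSum ts ρ₁ + costSum us ρ₂
  costSum-++ₜ [] us [] = refl
  costSum-++ₜ {Γ₂ = Γ₂} (_∷_ {Γ₁ = G₁} {Γ₂ = G₂} t ts) us {ρ₁} {ρ₂} p
    rewrite costSum-subst (sym (++-assoc G₁ G₂ Γ₂)) (t ∷ (ts ++ₜ us)) (ρ₁ ++ ρ₂)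
          | upto-++ G₁ {ρ' = ρ₂} p | from-++ G₁ {ρ' = ρ₂} p =
    trans (cong (cost t (upto G₁ ρ₁) +_) (costSum-++ₜ ts us (typed-from G₁ p)))
          (sym (+-assoc (cost t (upto G₁ ρ₁)) _ _))

  evals-ids : ∀ {ρ} → Typed as ρ → evals (ids as) ρ ≡ ρ
  evals-ids [] = refl
  evals-ids {ρ = (Δ , _) ∷ _} (_ ∷ ps) =
    cong₂ _∷_ (cong (_, _) (++-identityʳ Δ)) (evals-ids ps)

  costSum-ids : ∀ as {ρ} → costSum (ids as) ρ ≡ 0
  costSum-ids []       = refl
  costSum-ids (_ ∷ as) = costSum-ids as

  -- By linearity the entries of the evaluated list share out the environment among them, in order.
  -- Let layers therefore receive the same contexts before and after a substitution.
  ctxOf-evals : (ts : Tms Γ as) → ∀ {ρ} → Typed Γ ρ → ctxOf (evals ts ρ) ≡ ctxOf ρ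
  ctxOf-evals [] [] = refl
  ctxOf-evals (_∷_ {Γ₁ = G} t ts) {ρ} p =
    trans (cong (ctxOf (upto G ρ) ++_) (ctxOf-evals ts (typed-from G p)))
    (trans (sym (ctxOf-++ (upto G ρ) (from G ρ)))
           (cong ctxOf (upto++from G ρ)))

  evals-split : ∀ Γ₁ (σ : Tms Δ (Γ₁ ++ Γ₂)) ρ →
    let Δ₁ , _ , _ , σ₁ , σ₂ = split Γ₁ σ in
    evals σ ρ ≡ evals σ₁ (upto Δ₁ ρ) ++ evals σ₂ (from Δ₁ ρ)
  evals-split [] σ ρ = refl
  evals-split (a ∷ Γ₁) (_∷_ {Γ₁ = G} t σ) ρ
    with split Γ₁ σ | evals-split Γ₁ σ (from G ρ)
  ... | D₁ , D₂ , refl , σ₁ , σ₂ | ih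
    rewrite upto-upto G D₁ ρ | from-upto G D₁ ρ | from-from G D₁ ρ =
    cong (_ ∷_) ih

  costSum-split : ∀ Γ₁ (σ : Tms Δ (Γ₁ ++ Γ₂)) ρ →
    let Δ₁ , _ , _ , σ₁ , σ₂ = split Γ₁ σ in
    costSum σ ρ ≡ costSum σ₁ (upto Δ₁ ρ) + costSum σ₂ (from Δ₁ ρ)
  costSum-split [] σ ρ = refl
  costSum-split (a ∷ Γ₁) (_∷_ {Γ₁ = G} t σ) ρ
    with split Γ₁ σ | costSum-split Γ₁ σ (from G ρ)
  ... | D₁ , D₂ , refl , σ₁ , σ₂ | ih
    rewrite upto-upto G D₁ ρ | from-upto G D₁ ρ | from-from G D₁ ρ =
    trans (cong (cost t (upto G ρ) +_) ih) (sym (+-assoc (cost t (upto G ρ)) _ _))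

  isLT-sub : (s : Tm Γ b) (σ : Tms Δ Γ) → isLT s ≡ true → isLT (sub s σ) ≡ true
  isLT-sub (tup ts) σ e = refl
  isLT-sub (letin {as = as} {γ = γ} δ δ' s t) σ e with split δ σ
  ... | Δ₁ , Δ₂₃ , refl , σ₁ , σ₂₃ with split γ σ₂₃
  ... | Δ₂ , Δ₃ , refl , σ₂ , σ₃ = isLT-sub s (σ₁ ++ₜ ids as ++ₜ σ₃) e

  -- The two sides differ when a term without layers replaces a variable, which counts for one. This
  -- is why `eval-sub` is an inequality.
  ≲-load-store : ∀ v → v ≲ load (store v)
  ≲-load-store (zero  , _) = z≤n , refl , ≲C-refl
  ≲-load-store (suc _ , _) = ≲-refl

  upto-typed : ∀ {ρ} → Typed Γ ρ → upto Γ ρ ≡ ρ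
  upto-typed []       = refl
  upto-typed (_ ∷ ps) = cong (_ ∷_) (upto-typed ps)

  evals-under : (σ₁ : Tms Γ₁ δ) (σ₃ : Tms Γ₂ δ') → ∀ {ρ₁ ρ₂ ρ₃} →
    Typed Γ₁ ρ₁ → Typed as ρ₂ →
    evals (σ₁ ++ₜ ids as ++ₜ σ₃) (ρ₁ ++ ρ₂ ++ ρ₃) ≡
    evals σ₁ ρ₁ ++ ρ₂ ++ evals σ₃ ρ₃
  evals-under {as = as} σ₁ σ₃ p₁ p₂ = trans (evals-++ₜ σ₁ (ids as ++ₜ σ₃) p₁)
    (cong (_ ++_) (trans (evals-++ₜ (ids as) σ₃ p₂) (cong (_++ _) (evals-ids p₂))))

  -- The substitution lemma. Under a let, the body is evaluated with the components of a smaller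
  -- argument value, so `eval-mono` completes the induction.
  eval-sub  : (s : Tm Γ b) (σ : Tms Δ Γ) → ∀ {ρ} → Typed Δ ρ →
              eval (sub s σ) ρ ≲ eval s (evals σ ρ)
  evals-subs : (ts : Tms Γ as) (σ : Tms Δ Γ) → ∀ {ρ} → Typed Δ ρ →
              evals (subs ts σ) ρ ≲* evals ts (evals σ ρ)
  eval-sub var (_∷_ {Γ₁ = G} t []) {ρ} p
    rewrite eval-subst (sym (++-identityʳ G)) t ρ
          | upto-typed (subst (λ G → Typed G ρ) (++-identityʳ G) p) =
    ≲-load-store (eval t ρ)
  eval-sub (tup ts) σ p = ≤-refl , refl , tup (evals-subs ts σ p)
  eval-sub (app {b = b} f ts) σ p =
    ≲-reflexive (cong (λ rs → reflect b (app f rs)) (≲*-quote (evals-subs ts σ p)))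
  eval-sub (letin {as = as} {γ = γ} δ δ' s t) σ {ρ} p
    with split δ σ | evals-split δ σ ρ
  ... | Δ₁ , Δ₂₃ , refl , σ₁ , σ₂₃ | e₁
    with split γ σ₂₃ | evals-split γ σ₂₃ (from Δ₁ ρ)
  ... | Δ₂ , Δ₃ , refl , σ₂ , σ₃ | e₂ =
    ≲-trans
      (≲-bind (sym (ctxOf-evals σ₁ p₁)) (sym (ctxOf-evals σ₃ p₃)) q
        (≲-trans (eval-sub s (σ₁ ++ₜ ids as ++ₜ σ₃) (++⁺ p₁ (++⁺ pᵥ p₃)))
          (eval-mono s (≲*-trans (≲*-reflexive (evals-under σ₁ σ₃ p₁ pᵥ))
            (≲*-middle (evals σ₁ _) (evals σ₃ _) (proj₂ (proj₂ q)))))))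
      (≲-reflexive (sym (eval-letin s t (evals-typed σ₁ p₁) (evals-typed σ₂ p₂)
        (trans e₁ (cong (_ ++_) e₂)))))
    where
    p₁ = typed-upto Δ₁ p
    p₂ = typed-upto Δ₂ (typed-from Δ₁ p)
    p₃ = typed-from Δ₂ (typed-from Δ₁ p)
    q  = eval-sub t σ₂ p₂
    pᵥ = typed-comps (eval-typed (sub t σ₂) p₂)
  evals-subs [] [] [] = []
  evals-subs (_∷_ {Γ₁ = G} t ts) σ {ρ} p with split G σ | evals-split G σ ρ
  ... | Δ₁ , Δ₂ , refl , σ₁ , σ₂ | e
    rewrite e
          | upto-all (evals-typed σ₁ (typed-upto Δ₁ p)) {evals σ₂ (from Δ₁ ρ)}
          | from-all (evals-typed σ₁ (typed-upto Δ₁ p)) {evals σ₂ (from Δ₁ ρ)} =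
    ≲-store (sym (ctxOf-evals σ₁ (typed-upto Δ₁ p))) (eval-sub t σ₁ (typed-upto Δ₁ p))
    ∷ evals-subs ts σ₂ (typed-from Δ₁ p)

  -- Each substituted term occurs exactly once, so its cost is added once; the identities that pass
  -- under a binder add nothing.
  cost-sub  : (s : Tm Γ b) (σ : Tms Δ Γ) → ∀ {ρ} → Typed Δ ρ →
              cost (sub s σ) ρ ≤ cost s (evals σ ρ) + costSum σ ρ
  costE-sub : (s : Tm Γ b) (σ : Tms Δ Γ) → ∀ {ρ} → Typed Δ ρ →
              costE (sub s σ) ρ ≤ costE s (evals σ ρ) + costSum σ ρ
  costA-sub : (s : Tm Γ b) (σ : Tms Δ Γ) → ∀ {ρ} → Typed Δ ρ →
              costA (sub s σ) ρ ≤ costA s (evals σ ρ) + costSum σ ρ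
  costs-subs : (ts : Tms Γ as) (σ : Tms Δ Γ) → ∀ {ρ} → Typed Δ ρ →
              costs (subs ts σ) ρ ≤ costs ts (evals σ ρ) + costSum σ ρ
  cost-sub var (_∷_ {Γ₁ = G} t []) {ρ} p
    rewrite cost-subst (sym (++-identityʳ G)) t ρ
          | upto-typed (subst (λ G → Typed G ρ) (++-identityʳ G) p) =
    m≤m+n (cost t ρ) 0
  cost-sub (tup ts) σ p = costs-subs ts σ p
  cost-sub (app f ts) σ p = costs-subs ts σ p
  cost-sub (letin {as = as} {γ = γ} δ δ' s t) σ {ρ} p
    with split δ σ | evals-split δ σ ρ | costSum-split δ σ ρ
  ... | Δ₁ , Δ₂₃ , refl , σ₁ , σ₂₃ | e₁ | d₁
    with split γ σ₂₃ | evals-split γ σ₂₃ (from Δ₁ ρ) | costSum-split γ σ₂₃ (from Δ₁ ρ)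
  ... | Δ₂ , Δ₃ , refl , σ₂ , σ₃ | e₂ | d₂ =
    begin
      suc (cost (sub s τ) (ρ₁ ++ v' ++ ρ₃) + costA (sub t σ₂) ρ₂)
    ≤⟨ s≤s (+-mono-≤ (cost-sub s τ (++⁺ p₁ (++⁺ pᵥ p₃))) (costA-sub t σ₂ p₂)) ⟩
      suc ((cost s (evals τ (ρ₁ ++ v' ++ ρ₃)) + costSum τ (ρ₁ ++ v' ++ ρ₃))
           + (costA t (evals σ₂ ρ₂) + costSum σ₂ ρ₂))
    ≤⟨ s≤s (+-monoˡ-≤ _ (+-mono-≤
        (cost-mono s (≲*-trans (≲*-reflexive (evals-under σ₁ σ₃ p₁ pᵥ))
            (≲*-middle (evals σ₁ ρ₁) (evals σ₃ ρ₃) (proj₂ (proj₂ (eval-sub t σ₂ p₂))))))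
        (≤-reflexive (trans (costSum-++ₜ σ₁ (ids as ++ₜ σ₃) p₁)
          (cong (costSum σ₁ ρ₁ +_) (trans (costSum-++ₜ (ids as) σ₃ pᵥ)
            (cong (_+ costSum σ₃ ρ₃) (costSum-ids as {v'})))))))) ⟩
      suc ((x + (s₁ + s₃)) + (y + s₂))
    ≡⟨ cong suc (rearrange x y s₁ s₂ s₃) ⟩
      suc (x + y) + (s₁ + (s₂ + s₃))
    ≡⟨ cong₂ _+_ (cost-letin s t (evals-typed σ₁ p₁) (evals-typed σ₂ p₂)
                   (trans e₁ (cong (_ ++_) e₂)))
                 (trans d₁ (cong (s₁ +_) d₂)) ⟨
      cost (letin δ δ' s t) (evals σ ρ) + costSum σ ρ
    ∎
    where
    open ≤-Reasoning
    τ  = σ₁ ++ₜ ids as ++ₜ σ₃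
    ρ₁ = upto Δ₁ ρ
    ρ₂ = upto Δ₂ (from Δ₁ ρ)
    ρ₃ = from Δ₂ (from Δ₁ ρ)
    p₁ = typed-upto Δ₁ p
    p₂ = typed-upto Δ₂ (typed-from Δ₁ p)
    p₃ = typed-from Δ₂ (typed-from Δ₁ p)
    v' = comps (core (eval (sub t σ₂) ρ₂))
    v  = comps (core (eval t (evals σ₂ ρ₂)))
    pᵥ = typed-comps (eval-typed (sub t σ₂) p₂)
    x  = cost s (evals σ₁ ρ₁ ++ v ++ evals σ₃ ρ₃)
    y  = costA t (evals σ₂ ρ₂)
    s₁ = costSum σ₁ ρ₁
    s₂ = costSum σ₂ ρ₂
    s₃ = costSum σ₃ ρ₃
    rearrange : ∀ x y s₁ s₂ s₃ →
                (x + (s₁ + s₃)) + (y + s₂) ≡ x + y + (s₁ + (s₂ + s₃))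
    rearrange = solve-∀
  costE-sub s σ {ρ} p = begin
    cost (sub s σ) ρ + penalty (isLT (sub s σ)) (eval (sub s σ) ρ)
      ≤⟨ +-mono-≤ (cost-sub s σ p) (penalty-mono (isLT-sub s σ) (eval-sub s σ p)) ⟩
    (cost s (evals σ ρ) + costSum σ ρ) + penalty (isLT s) (eval s (evals σ ρ))
      ≡⟨ xy∙z≈xz∙y +-commutativeSemigroup (cost s (evals σ ρ)) (costSum σ ρ) _ ⟩
    costE s (evals σ ρ) + costSum σ ρ ∎
    where open ≤-Reasoning
  costA-sub s σ {ρ} p = begin
    cost (sub s σ) ρ + penaltyArg (isLT (sub s σ)) (eval (sub s σ) ρ)
      ≤⟨ +-mono-≤ (cost-sub s σ p) (penaltyArg-mono (isLT-sub s σ) (eval-sub s σ p)) ⟩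
    (cost s (evals σ ρ) + costSum σ ρ) + penaltyArg (isLT s) (eval s (evals σ ρ))
      ≡⟨ xy∙z≈xz∙y +-commutativeSemigroup (cost s (evals σ ρ)) (costSum σ ρ) _ ⟩
    costA s (evals σ ρ) + costSum σ ρ ∎
    where open ≤-Reasoning
  costs-subs [] [] [] = z≤n
  costs-subs (_∷_ {Γ₁ = G} t ts) σ {ρ} p
    with split G σ | evals-split G σ ρ | costSum-split G σ ρ
  ... | Δ₁ , Δ₂ , refl , σ₁ , σ₂ | e | d
    rewrite e | d
          | upto-all (evals-typed σ₁ (typed-upto Δ₁ p)) {evals σ₂ (from Δ₁ ρ)}
          | from-all (evals-typed σ₁ (typed-upto Δ₁ p)) {evals σ₂ (from Δ₁ ρ)} =
    ≤-trans (+-mono-≤ (costE-sub t σ₁ (typed-upto Δ₁ p)) (costs-subs ts σ₂ (typed-from Δ₁ p)))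
      (≤-reflexive (interchange +-commutativeSemigroup (costE t (evals σ₁ (upto Δ₁ ρ))) _ _ _))

  -- β-steps

  -- bind without rounding m up to 1: the tuple under the stack of a β-redex
  -- contributes no layer.
  join : Ctx → Ctx → Val → Val → Val
  join δ δ' (m , ls , _) (m' , ls' , c) = m + m' , map (shift δ δ') ls ++ ls' , c

  join≲bind : ∀ δ δ' u v → join δ δ' u v ≲ bind δ δ' u v
  join≲bind δ δ' (m , _) (m' , _) = +-monoˡ-≤ m' (suc-pred-≤ m) , refl , ≲C-refl
    where
    suc-pred-≤ : ∀ m → m ≤ suc (pred m)
    suc-pred-≤ zero    = z≤n
    suc-pred-≤ (suc m) = ≤-refl

  regroup : ∀ {X : Set} (xs ys zs us vs : List X) →
            xs ++ (ys ++ zs ++ us) ++ vs ≡ (xs ++ ys) ++ zs ++ (us ++ vs)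
  regroup xs ys zs us vs = trans
    (cong (xs ++_) (trans (++-assoc ys (zs ++ us) vs)
                          (cong (ys ++_) (++-assoc zs us vs))))
    (sym (++-assoc xs ys (zs ++ us ++ vs)))

  shift-shift : ∀ δ δ' ε ε' ls →
    map (shift δ δ') (map (shift ε ε') ls) ≡ map (shift (δ ++ ε) (ε' ++ δ')) ls
  shift-shift δ δ' ε ε' ls = trans (sym (map-∘ ls))
    (map-cong (λ { (ι , ι' , r) → cong₂ (λ x y → x , y , r)
                     (sym (++-assoc δ ε ι)) (++-assoc ι' ε' δ') }) ls)

  -- Stacking layers is associative: on both sides only the count of `u` is rounded. This is the
  -- inductive step for moving a let stack out of a β-redex.
  join-bind : ∀ δ δ' ε ε' u v w →
    bind (δ ++ ε) (ε' ++ δ') u (join δ δ' v w) ≡ join δ δ' (bind ε ε' u v) w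
  join-bind δ δ' ε ε' (m , ls , _) (m' , ls' , _) (m'' , ls'' , c) =
    cong₂ (λ x y → x , y , c) (sym (+-assoc (suc (pred m)) m' m''))
      (sym (trans (cong (_++ ls'') (trans (map-++ (shift δ δ') (map (shift ε ε') ls) ls')
                      (cong (_++ _) (shift-shift δ δ' ε ε' ls))))
                  (++-assoc (map (shift (δ ++ ε) (ε' ++ δ')) ls) _ ls'')))

  eval-plugL-subst : ∀ {G D} (e : G ≡ D) (L : Stk Γ₀ G) (u : Tm Γ₀ a) ρ →
    eval (plugL (subst (Stk Γ₀) e L) u) ρ ≡ eval (plugL L u) ρ
  eval-plugL-subst refl L u ρ = refl

  cost-plugL-subst : ∀ {G D} (e : G ≡ D) (L : Stk Γ₀ G) (u : Tm Γ₀ a) ρ →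
    cost (plugL (subst (Stk Γ₀) e L) u) ρ ≡ cost (plugL L u) ρ
  cost-plugL-subst refl L u ρ = refl

  isLT-plugL : (L : Stk Γ₀ Γ) (u : Tm Γ₀ a) → isLT (plugL L u) ≡ isLT u
  isLT-plugL [·]            u = refl
  isLT-plugL (lay ε ε' L t) u = isLT-plugL L u

  evals-between : ∀ (ts : Tms Γ as) {ρ₁ ρ₂ ρ₃} →
    Typed δ ρ₁ → Typed Γ ρ₂ → Typed δ' ρ₃ →
    evals (ids δ ++ₜ ts ++ₜ ids δ') (ρ₁ ++ ρ₂ ++ ρ₃) ≡ ρ₁ ++ evals ts ρ₂ ++ ρ₃
  evals-between {δ = δ} {δ' = δ'} ts p₁ p₂ p₃ =
    trans (evals-++ₜ (ids δ) (ts ++ₜ ids δ') p₁)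
      (cong₂ _++_ (evals-ids p₁) (trans (evals-++ₜ ts (ids δ') p₂)
        (cong (evals ts _ ++_) (evals-ids p₃))))

  costSum-between : ∀ (ts : Tms Γ as) {ρ₁ ρ₂ ρ₃} → Typed δ ρ₁ → Typed Γ ρ₂ →
    costSum (ids δ ++ₜ ts ++ₜ ids δ') (ρ₁ ++ ρ₂ ++ ρ₃) ≡ costSum ts ρ₂
  costSum-between {δ = δ} {δ' = δ'} ts {ρ₁} {ρ₂} {ρ₃} p₁ p₂ =
    trans (costSum-++ₜ (ids δ) (ts ++ₜ ids δ') p₁)
      (trans (cong₂ _+_ (costSum-ids δ {ρ₁}) (costSum-++ₜ ts (ids δ') p₂))
        (trans (cong (costSum ts ρ₂ +_) (costSum-ids δ' {ρ₃})) (+-identityʳ _)))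

  costSum≤costs : (ts : Tms Γ as) → ∀ ρ → costSum ts ρ ≤ costs ts ρ
  costSum≤costs [] ρ = z≤n
  costSum≤costs (_∷_ {Γ₁ = G} t ts) ρ =
    +-mono-≤ (m≤m+n (cost t (upto G ρ)) _) (costSum≤costs ts (from G ρ))

  upto₃ : ∀ δ γ ρ → ρ ≡ upto δ ρ ++ upto γ (from δ ρ) ++ from γ (from δ ρ)
  upto₃ δ γ ρ = sym (trans (cong (upto δ ρ ++_) (upto++from γ (from δ ρ))) (upto++from δ ρ))

  module _ {δ δ' : Ctx} (s : Tm (δ ++ as ++ δ') b) (ts : Tms Γ₀ as) where

    private
      u = sub s (ids δ ++ₜ ts ++ₜ ids δ')

    -- By induction on the stack: the empty stack is the substitution lemma, and each further layer
    -- is an instance of `join-bind`.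
    eval-plug-frame : ∀ (L : Stk Γ₀ γ) {ρ₁ ρ₂ ρ₃} →
      Typed δ ρ₁ → Typed γ ρ₂ → Typed δ' ρ₃ →
      eval (plugL (frame δ δ' L) u) (ρ₁ ++ ρ₂ ++ ρ₃) ≲
      join (ctxOf ρ₁) (ctxOf ρ₃) (eval (plugL L (tup ts)) ρ₂)
        (eval s (ρ₁ ++ comps (core (eval (plugL L (tup ts)) ρ₂)) ++ ρ₃))
    eval-plug-frame [·] p₁ p₂ p₃ =
      ≲-trans (eval-sub s _ (++⁺ p₁ (++⁺ p₂ p₃)))
        (eval-mono s (≲*-reflexive (evals-between ts p₁ p₂ p₃)))
    eval-plug-frame (lay {as = as'} {γ = γ'} ε ε' L t) {ρ₁} {ρ₂} {ρ₃} p₁ p₂ p₃ =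
      ≲-trans (≲-reflexive (trans
        (eval-plugL-subst (sym (reassoc δ ε γ' ε' δ')) _ u _)
        (eval-letin (plugL L' u) t (++⁺ p₁ q₁) q₂
          (trans (cong (λ ρ → ρ₁ ++ ρ ++ ρ₃) (upto₃ ε γ' ρ₂)) (regroup ρ₁ σ₁ σ₂ σ₃ ρ₃)))))
      (≲-trans (≲-bind {u = eval t σ₂} (ctxOf-++ ρ₁ σ₁) (ctxOf-++ σ₃ ρ₃) ≲-refl
        (≲-trans (≲-reflexive (trans
            (eval-plugL-subst (reassoc δ ε as' ε' δ') (frame δ δ' L) u _)
            (cong (eval (plugL (frame δ δ' L) u)) (sym (regroup ρ₁ σ₁ _ σ₃ ρ₃)))))
          (eval-plug-frame L p₁ (++⁺ q₁ (++⁺ (typed-comps (eval-typed t q₂)) q₃)) p₃)))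
      (≲-reflexive (join-bind (ctxOf ρ₁) (ctxOf ρ₃) (ctxOf σ₁) (ctxOf σ₃) (eval t σ₂)
        (eval (plugL L (tup ts)) (σ₁ ++ comps (core (eval t σ₂)) ++ σ₃)) _)))
      where
      L' = subst (Stk (δ ++ Γ₀ ++ δ')) (reassoc δ ε as' ε' δ') (frame δ δ' L)
      σ₁ = upto ε ρ₂
      σ₂ = upto γ' (from ε ρ₂)
      σ₃ = from γ' (from ε ρ₂)
      q₁ = typed-upto ε p₂
      q₂ = typed-upto γ' (typed-from ε p₂)
      q₃ = typed-from γ' (typed-from ε p₂)

    -- The bound leaves out the unit charged for the let of the redex, which is what β gains.
    cost-plug-frame : ∀ (L : Stk Γ₀ γ) {ρ₁ ρ₂ ρ₃} →
      Typed δ ρ₁ → Typed γ ρ₂ → Typed δ' ρ₃ →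
      cost (plugL (frame δ δ' L) u) (ρ₁ ++ ρ₂ ++ ρ₃) ≤
      cost s (ρ₁ ++ comps (core (eval (plugL L (tup ts)) ρ₂)) ++ ρ₃)
        + cost (plugL L (tup ts)) ρ₂
    cost-plug-frame [·] {ρ₂ = ρ₂} p₁ p₂ p₃ =
      ≤-trans (cost-sub s _ (++⁺ p₁ (++⁺ p₂ p₃)))
        (+-mono-≤ (cost-mono s (≲*-reflexive (evals-between ts p₁ p₂ p₃)))
          (≤-trans (≤-reflexive (costSum-between ts p₁ p₂)) (costSum≤costs ts ρ₂)))
    cost-plug-frame (lay {as = as'} {γ = γ'} ε ε' L t) {ρ₁} {ρ₂} {ρ₃} p₁ p₂ p₃ =
      ≤-trans (≤-reflexive (trans
        (cost-plugL-subst (sym (reassoc δ ε γ' ε' δ')) _ u _)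
        (cost-letin (plugL L' u) t (++⁺ p₁ q₁) q₂
          (trans (cong (λ ρ → ρ₁ ++ ρ ++ ρ₃) (upto₃ ε γ' ρ₂)) (regroup ρ₁ σ₁ σ₂ σ₃ ρ₃)))))
      (≤-trans (s≤s (+-monoˡ-≤ (costA t σ₂)
        (≤-trans (≤-reflexive (trans
            (cost-plugL-subst (reassoc δ ε as' ε' δ') (frame δ δ' L) u _)
            (cong (cost (plugL (frame δ δ' L) u)) (sym (regroup ρ₁ σ₁ _ σ₃ ρ₃)))))
          (cost-plug-frame L p₁ (++⁺ q₁ (++⁺ (typed-comps (eval-typed t q₂)) q₃)) p₃))))
      (≤-reflexive (rearrange (cost s _) _ (costA t σ₂))))
      where
      L' = subst (Stk (δ ++ Γ₀ ++ δ')) (reassoc δ ε as' ε' δ') (frame δ δ' L)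
      σ₁ = upto ε ρ₂
      σ₂ = upto γ' (from ε ρ₂)
      σ₃ = from γ' (from ε ρ₂)
      q₁ = typed-upto ε p₂
      q₂ = typed-upto γ' (typed-from ε p₂)
      q₃ = typed-from γ' (typed-from ε p₂)
      rearrange : ∀ x y z → suc (x + y + z) ≡ x + suc (y + z)
      rearrange = solve-∀

  -- l ⊐ r holds for all steps; l ⊐ₐ r, which is needed under letArgH, fails
  -- for η at the root.
  infix 4 _⊐_ _⊐ₐ_ _⊐*_

  record _⊐_ (l r : Tm Γ a) : Set where
    field
      eval-⊐  : ∀ {ρ} → Typed Γ ρ → eval r ρ ≲ eval l ρ
      isLT-⊐  : isLT l ≡ true → isLT r ≡ true
      costE-⊐ : ∀ {ρ} → Typed Γ ρ → costE r ρ < costE l ρ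
  open _⊐_

  record _⊐ₐ_ (l r : Tm Γ a) : Set where
    field
      weaken  : l ⊐ r
      costA-⊐ : ∀ {ρ} → Typed Γ ρ → costA r ρ < costA l ρ
  open _⊐ₐ_

  _⊐*_ : Tms Γ as → Tms Γ as → Set
  _⊐*_ {Γ = Γ} ls rs =
    ∀ {ρ} → Typed Γ ρ → evals rs ρ ≲* evals ls ρ × costs rs ρ < costs ls ρ

  -- Root penalties are monotone, so a strict decrease of `cost` decides both positions at once.
  ⊐ₐ-intro : ∀ {l r : Tm Γ a} →
    (∀ {ρ} → Typed Γ ρ → eval r ρ ≲ eval l ρ × cost r ρ < cost l ρ) →
    (isLT l ≡ true → isLT r ≡ true) → l ⊐ₐ r
  ⊐ₐ-intro h lt = record
    { weaken = record
        { eval-⊐  = λ p → proj₁ (h p)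
        ; isLT-⊐  = lt
        ; costE-⊐ = λ p → +-mono-<-≤ (proj₂ (h p)) (penalty-mono lt (proj₁ (h p)))
        }
    ; costA-⊐ = λ p → +-mono-<-≤ (proj₂ (h p)) (penaltyArg-mono lt (proj₁ (h p)))
    }

  penaltyArg-LT : ∀ {b} v → b ≡ true → penaltyArg b v ≡ 0
  penaltyArg-LT v refl = refl

  β-⊐ₐ : ∀ {l r : Tm Γ b} → BetaRoot l r → l ⊐ₐ r
  β-⊐ₐ (β {γ = γ} δ δ' s L ts) = ⊐ₐ-intro
    (λ {ρ} p →
      let p₁ = typed-upto δ p
          p₂ = typed-upto γ (typed-from δ p)
          p₃ = typed-from γ (typed-from δ p)
          ρ₁ = upto δ ρ
          ρ₂ = upto γ (from δ ρ)
          ρ₃ = from γ (from δ ρ)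
          T  = plugL L (tup ts)
          R  = plugL (frame δ δ' L) (sub s (ids δ ++ₜ ts ++ₜ ids δ'))
      in
      ≲-trans (≲-reflexive (cong (eval R) (upto₃ δ γ ρ)))
        (≲-trans (eval-plug-frame s ts L p₁ p₂ p₃)
                 (join≲bind _ _ (eval T ρ₂) _)) ,
      -- The strict decrease is the unit for the contracted let. Its argument lies in LT and so adds
      -- no penalty to the bound.
      s≤s (≤-trans (≤-reflexive (cong (cost R) (upto₃ δ γ ρ)))
        (≤-trans (cost-plug-frame s ts L p₁ p₂ p₃)
          (≤-reflexive (cong (cost s (ρ₁ ++ comps (core (eval T ρ₂)) ++ ρ₃) +_)
            (trans (sym (+-identityʳ _))
              (cong (cost T ρ₂ +_)
                (sym (penaltyArg-LT (eval T ρ₂) (isLT-plugL L (tup ts)))))))))))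
    (λ e → trans (isLT-plugL (frame δ δ' L) _) (isLT-sub s _ e))

  -- η-steps

  InLT-isLT : (s : Tm Γ (⊗ as)) → isLT s ≡ true → InLT s
  InLT-isLT (tup ts)         e = _ , [·] , ts , refl
  InLT-isLT (letin δ δ' s t) e with InLT-isLT s e
  ... | _ , L , ts , refl = _ , lay δ δ' L t , ts , refl

  ¬InLT-isLT : (s : Tm Γ (⊗ as)) → ¬ InLT s → isLT s ≡ false
  ¬InLT-isLT s h with isLT s in e
  ... | true  = ⊥-elim (h (InLT-isLT s e))
  ... | false = refl

  -- The tuple of variables introduced by η costs exactly this much; `weights` is defined so as to
  -- make this equation hold.
  costs-ids : ∀ {ρ} → Typed as ρ → costs (ids as) ρ ≡ weights ρ
  costs-ids []       = refl
  costs-ids {ρ = (_ , m , _ , c) ∷ _} (_ ∷ ps) =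
    cong (suc (suc m) * (2 + weight c) +_) (costs-ids ps)

  shift-nil : ∀ ls → map (shift [] []) ls ≡ ls
  shift-nil ls = trans (map-cong (λ { (ε , ε' , r) →
    cong (λ x → ε , x , r) (++-identityʳ ε') }) ls) (map-id ls)

  -- Outside LT there is at least one layer, so the rounding in `bind` changes nothing and η
  -- preserves values exactly.
  positive : (s : Tm Γ a) → isLT s ≡ false → ∀ {ρ} → Typed Γ ρ →
             suc (pred (proj₁ (eval s ρ))) ≡ proj₁ (eval s ρ)
  positive var              e (_ ∷ []) = refl
  positive (letin _ _ s t)  e p = refl
  positive (app {b = atom _} f ts) e p = refl
  positive (app {b = ⊗ _} f ts) e p = refl

  eval-ηexp : (s : Tm Γ (⊗ as)) → ∀ {ρ} → Typed Γ ρ →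
    eval (ηexp s) ρ ≡ bind [] [] (eval s ρ)
      (0 , [] , tup (comps (core (eval s ρ)))) ×
    cost (ηexp s) ρ ≡ suc (weights (comps (core (eval s ρ))) + costA s ρ)
  eval-ηexp {Γ} {as} s {ρ} p =
    trans (trans (eval-subst (++-identityʳ Γ) (letin [] [] body s) ρ)
             (eval-letin body s [] p (sym (++-identityʳ ρ))))
          (cong (bind [] [] (eval s ρ)) (trans (eval-subst (sym (++-identityʳ as)) _ _)
            (cong (λ vs → 0 , [] , tup vs)
              (trans (cong (evals (ids as)) (++-identityʳ _)) (evals-ids q))))) ,
    trans (trans (cost-subst (++-identityʳ Γ) (letin [] [] body s) ρ)
             (cost-letin body s [] p (sym (++-identityʳ ρ))))
          (cong (λ x → suc (x + costA s ρ)) (trans (cost-subst (sym (++-identityʳ as)) _ _)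
              (trans (cong (costs (ids as)) (++-identityʳ _)) (costs-ids q))))
    where
    body = subst (λ G → Tm G (⊗ as)) (sym (++-identityʳ as)) (tup (ids as))
    q    = typed-comps (eval-typed s p)

  isLT-ηexp : (s : Tm Γ (⊗ as)) → isLT (ηexp s) ≡ true
  isLT-ηexp {Γ} {as} s = trans (isLT-subst (++-identityʳ Γ) _)
    (isLT-subst (sym (++-identityʳ as)) (tup (ids as)))

  eval-ηexp-≡ : (s : Tm Γ (⊗ as)) → isLT s ≡ false → ∀ {ρ} → Typed Γ ρ →
    eval (ηexp s) ρ ≡ eval s ρ
  eval-ηexp-≡ s e {ρ} p = trans (proj₁ (eval-ηexp s p))
    (cong₂ _,_ (trans (+-identityʳ _) (positive s e p))
      (cong₂ _,_ (trans (++-identityʳ _) (shift-nil _)) (tup-comps (eval-typed s p))))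
    where
    tup-comps : ∀ {c} → TypedC (⊗ as) c → tup (comps c) ≡ c
    tup-comps (tup _) = refl

  penalty-LT : ∀ {b} v → b ≡ true → penalty b v ≡ 0
  penalty-LT v refl = refl

  -- With `w` the weight and `k = 2 + w`, moving to an argument position saves `k`. The new let
  -- takes 1 and the variables `w`, which leaves 1 for strictness.
  η-budget : ∀ {b} v → b ≡ false → suc (weight (core v) + penaltyArg b v) < penalty b v
  η-budget (m , _ , c) refl =
    +-monoˡ-< (m * (2 + weight c)) (n<1+n (suc (weight c)))

  weights-comps : ∀ c → weights (comps c) ≡ weight c
  weights-comps (tup _) = refl
  weights-comps (ne _)  = refl

  -- The expansion lies in LT and pays no root penalty, while `s` becomes the argument of a let and
  -- pays the smaller penalty.
  η-⊐ : ∀ {l r : Tm Γ b} → EtaRoot l r → l ⊐ r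
  η-⊐ (η s h) = record
    { eval-⊐  = λ p → ≲-reflexive (eval-ηexp-≡ s e p)
    ; isLT-⊐  = λ _ → isLT-ηexp s
    ; costE-⊐ = λ {ρ} p → begin-strict
        cost (ηexp s) ρ + penalty (isLT (ηexp s)) (eval (ηexp s) ρ)
          ≡⟨ cong (cost (ηexp s) ρ +_) (penalty-LT (eval (ηexp s) ρ) (isLT-ηexp s)) ⟩
        cost (ηexp s) ρ + 0
          ≡⟨ +-identityʳ _ ⟩
        cost (ηexp s) ρ
          ≡⟨ proj₂ (eval-ηexp s p) ⟩
        suc (weights (comps (core (eval s ρ))) + costA s ρ)
          ≡⟨ cong (λ x → suc (x + costA s ρ)) (weights-comps (core (eval s ρ))) ⟩
        suc (weight (core (eval s ρ)) + (cost s ρ + penaltyArg (isLT s) (eval s ρ)))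
          ≡⟨ rearrange (weight (core (eval s ρ))) (cost s ρ) _ ⟩
        cost s ρ + suc (weight (core (eval s ρ)) + penaltyArg (isLT s) (eval s ρ))
          <⟨ +-monoʳ-< (cost s ρ) (η-budget (eval s ρ) e) ⟩
        costE s ρ ∎
    }
    where
    open ≤-Reasoning
    e = ¬InLT-isLT s h
    rearrange : ∀ x y z → suc (x + (y + z)) ≡ y + suc (x + z)
    rearrange = solve-∀

  -- Closure under contexts

  penalty-bind : ∀ b δ δ' u v →
    penalty b (bind δ δ' u v) ≡
    penalty b v + unlessLT b (suc (pred (proj₁ u)) * (2 + weight (core v)))
  penalty-bind true  δ δ' u v = refl
  penalty-bind false δ δ' (m , _) (m' , _ , c) = distrib (pred m) m' (2 + weight c)
    where
    distrib : ∀ x y k → suc (suc x + y) * k ≡ suc y * k + suc x * k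
    distrib = solve-∀

  -- The new let contributes at least one layer, by the rounding in `bind`. So even in argument
  -- position the full penalty of the body is contained in the penalty of the let, and η at the root
  -- of the body is paid for.
  penaltyArg-bind : ∀ b δ δ' u v →
    penaltyArg b (bind δ δ' u v) ≡
    penalty b v + unlessLT b (pred (proj₁ u) * (2 + weight (core v)))
  penaltyArg-bind true  δ δ' u v = refl
  penaltyArg-bind false δ δ' (m , _) (m' , _ , c) = distrib (pred m) m' (2 + weight c)
    where
    distrib : ∀ x y k → (suc x + y) * k ≡ suc y * k + x * k
    distrib = solve-∀

  body-⊐ₐ : ∀ δ δ' {l r : Tm (δ ++ as ++ δ') b} (t : Tm γ (⊗ as)) →
    l ⊐ r → letin δ δ' l t ⊐ₐ letin δ δ' r t
  body-⊐ₐ {as = as} {γ = γ} δ δ' {l} {r} t d = record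
    { weaken = record
        { eval-⊐  = λ p → ≲-bind {u = eval t _} refl refl ≲-refl (eval-⊐ d (extend p))
        ; isLT-⊐  = isLT-⊐ d
        ; costE-⊐ = λ {ρ} p → bound (extend p) (costA t _) (suc (pred (layers ρ)))
            -- Penalties do not look at the contexts of layers, so empty contexts serve here.
            (penalty-bind (isLT r) [] [] (eval t _) (eval r _))
            (penalty-bind (isLT l) [] [] (eval t _) (eval l _))
        }
    ; costA-⊐ = λ {ρ} p → bound (extend p) (costA t _) (pred (layers ρ))
            (penaltyArg-bind (isLT r) [] [] (eval t _) (eval r _))
            (penaltyArg-bind (isLT l) [] [] (eval t _) (eval l _))
    }
    where
    layers : Env → ℕ
    layers ρ = proj₁ (eval t (upto γ (from δ ρ)))
    extend : ∀ {ρ} → Typed (δ ++ γ ++ δ') ρ →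
      Typed (δ ++ as ++ δ')
        (upto δ ρ ++ comps (core (eval t (upto γ (from δ ρ)))) ++ from γ (from δ ρ))
    extend p = ++⁺ (typed-upto δ p)
      (++⁺ (typed-comps (eval-typed t (typed-upto γ (typed-from δ p))))
           (typed-from γ (typed-from δ p)))
    rearrange : ∀ x y z w → suc (x + y) + (z + w) ≡ x + z + (suc y + w)
    rearrange = solve-∀
    bound : ∀ {ρ} → Typed (δ ++ as ++ δ') ρ → ∀ n k {x y} →
      x ≡ penalty (isLT r) (eval r ρ) +
            unlessLT (isLT r) (k * (2 + weight (core (eval r ρ)))) →
      y ≡ penalty (isLT l) (eval l ρ) +
            unlessLT (isLT l) (k * (2 + weight (core (eval l ρ)))) →
      suc (cost r ρ + n) + x < suc (cost l ρ + n) + y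
    bound {ρ} p n k refl refl = subst₂ _<_
      (sym (rearrange (cost r ρ) n _ _)) (sym (rearrange (cost l ρ) n _ _))
      (+-mono-<-≤ (costE-⊐ d p) (+-monoʳ-≤ (suc n) (unlessLT-mono (isLT-⊐ d)
        (*-monoʳ-≤ k (+-monoʳ-≤ 2 (weight-mono (proj₂ (proj₂ (eval-⊐ d p)))))))))

  arg-⊐ₐ : ∀ δ δ' (s : Tm (δ ++ as ++ δ') b) {l r : Tm γ (⊗ as)} →
    l ⊐ₐ r → letin δ δ' s l ⊐ₐ letin δ δ' s r
  arg-⊐ₐ {γ = γ} δ δ' s {l} {r} d = ⊐ₐ-intro
    (λ {ρ} p →
      let q  = typed-upto γ (typed-from δ p)
          v  = eval-⊐ (weaken d) q
          vs = ≲*-middle (upto δ ρ) (from γ (from δ ρ)) (proj₂ (proj₂ v))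
      in ≲-bind refl refl v (eval-mono s vs) ,
         s≤s (+-mono-≤-< (cost-mono s vs) (costA-⊐ d q)))
    (λ e → e)

  tup-⊐ₐ : ∀ {ls rs : Tms Γ as} → ls ⊐* rs → tup ls ⊐ₐ tup rs
  tup-⊐ₐ d = ⊐ₐ-intro
    (λ p → (≤-refl , refl , tup (proj₁ (d p))) , proj₂ (d p)) (λ e → e)

  app-⊐ₐ : ∀ (f : ℛ as b) {ls rs : Tms Γ as} → ls ⊐* rs → app f ls ⊐ₐ app f rs
  app-⊐ₐ {b = b} f d = ⊐ₐ-intro
    (λ p → ≲-reflexive (cong (λ rs → reflect b (app f rs)) (≲*-quote (proj₁ (d p)))) ,
           proj₂ (d p)) (λ e → e)

  ⊐*-subst : ∀ {G D} (e : G ≡ D) {ls rs : Tms G as} → ls ⊐* rs →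
    subst (λ D → Tms D as) e ls ⊐* subst (λ D → Tms D as) e rs
  ⊐*-subst refl d = d

  insert-⊐* : ∀ (ts : Tms Γ₁ as) {l r : Tm Γ a} (us : Tms Γ₂ bs) → l ⊐ r →
    (ts ++ₜ l ∷ us) ⊐* (ts ++ₜ r ∷ us)
  insert-⊐* {Γ = Γ} [] us d p =
    ≲-store refl (eval-⊐ d q) ∷ ≲*-refl , +-monoˡ-< _ (costE-⊐ d q)
    where q = typed-upto Γ p
  insert-⊐* {Γ = Γ} {Γ₂ = Γ₂} (_∷_ {Γ₁ = G₁} {Γ₂ = G₂} t ts) {l} {r} us d =
    ⊐*-subst (sym (++-assoc G₁ G₂ (Γ ++ Γ₂)))
      {ls = t ∷ (ts ++ₜ l ∷ us)} {rs = t ∷ (ts ++ₜ r ∷ us)} λ {ρ} p →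
        let ih = insert-⊐* ts {l} {r} us d (typed-from G₁ p)
        in ≲-store {v = eval t (upto G₁ ρ)} refl ≲-refl ∷ proj₁ ih ,
           +-monoʳ-< (costE t (upto G₁ ρ)) (proj₂ ih)

  plug-⊐ₐ : (C : Hole Γh ah Γ a) {l r : Tm Γh ah} → l ⊐ₐ r → plug C l ⊐ₐ plug C r
  plug-⊐ₐ [·] d                   = d
  plug-⊐ₐ (tupH ts C us) d        = tup-⊐ₐ (insert-⊐* ts us (weaken (plug-⊐ₐ C d)))
  plug-⊐ₐ (letBodyH δ δ' C t) d   = body-⊐ₐ δ δ' t (weaken (plug-⊐ₐ C d))
  plug-⊐ₐ (letArgH δ δ' s C) d    = arg-⊐ₐ δ δ' s (plug-⊐ₐ C d)
  plug-⊐ₐ (appH f ts C us) d      = app-⊐ₐ f (insert-⊐* ts us (weaken (plug-⊐ₐ C d)))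

  -- Every context other than the hole strengthens `⊐` to `⊐ₐ`, and an E-context enters the argument
  -- of a let only through such a context.
  plug-⊐  : (C : Hole Γh ah Γ a) → IsE C → ∀ {l r : Tm Γh ah} →
            l ⊐ r → plug C l ⊐ plug C r
  plug-⊐ᵢ : (C : Hole Γh ah Γ a) → IsE C → NotHole C → ∀ {l r : Tm Γh ah} →
            l ⊐ r → plug C l ⊐ₐ plug C r
  plug-⊐ [·] e d                        = d
  plug-⊐ C@(tupH _ _ _) e d             = weaken (plug-⊐ᵢ C e tt d)
  plug-⊐ C@(letBodyH _ _ _ _) e d       = weaken (plug-⊐ᵢ C e tt d)
  plug-⊐ C@(letArgH _ _ _ _) e d        = weaken (plug-⊐ᵢ C e tt d)
  plug-⊐ C@(appH _ _ _ _) e d           = weaken (plug-⊐ᵢ C e tt d)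
  plug-⊐ᵢ (tupH ts C us) (tupH e) _ d       = tup-⊐ₐ (insert-⊐* ts us (plug-⊐ C e d))
  plug-⊐ᵢ (letBodyH δ δ' C t) (letBodyH e) _ d = body-⊐ₐ δ δ' t (plug-⊐ C e d)
  plug-⊐ᵢ (letArgH δ δ' s C) (letArgH e n) _ d = arg-⊐ₐ δ δ' s (plug-⊐ᵢ C e n d)
  plug-⊐ᵢ (appH f ts C us) (appH e) _ d     = app-⊐ₐ f (insert-⊐* ts us (plug-⊐ C e d))

  -- Strong normalization.

  ⟶rep-⊐ : ∀ {s t : Tm Γ a} → s ⟶rep t → s ⊐ t
  ⟶rep-⊐ (inj₁ (ctx C b))   = weaken (plug-⊐ₐ C (β-⊐ₐ b))
  ⟶rep-⊐ (inj₂ (ctx C e h)) = plug-⊐ C e (η-⊐ h)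

  -- A whole term admits η at its root, so the measure is `costE`, taken in the identity
  -- environment.
  ⟶rep-sn : StronglyNormalizing (_⟶rep_ {Γ} {a})
  ⟶rep-sn {Γ} = Subrelation.wellFounded
    (λ h → costE-⊐ (⟶rep-⊐ h) (idEnv-typed Γ))
    (On.wellFounded (λ t → costE t (idEnv Γ)) <-wellFounded)

  -- Normal forms

  normalForm : Tm Γ a → Raw
  normalForm {Γ} t = quoteV (eval t (idEnv Γ))

  normalForm-↠ : ∀ {s t : Tm Γ a} → Star _⟶rep_ s t → normalForm t ≡ normalForm s
  normalForm-↠ done     = refl
  normalForm-↠ (h ◅ hs) =
    trans (normalForm-↠ hs) (≲-quote (eval-⊐ (⟶rep-⊐ h) (idEnv-typed _)))

  -- Long forms: a neutral term is normal by itself only at an atomic type; at a tensor type it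
  -- occurs only as the argument of a let.
  data Nf      : Tm Γ a → Set
  data Nfs     : Tms Γ as → Set
  data Neutral : Tm Γ a → Set

  data Nf where
    ne    : ∀ {o} {t : Tm Γ (atom o)} → Neutral t → Nf t
    tup   : {ts : Tms Γ as} → Nfs ts → Nf (tup ts)
    letin : ∀ {δ δ'} {s : Tm (δ ++ as ++ δ') b} {t : Tm γ (⊗ as)} →
            Nf s → Neutral t → Nf (letin δ δ' s t)

  data Nfs where
    []  : Nfs []
    _∷_ : {t : Tm Γ₁ a} {ts : Tms Γ₂ as} → Nf t → Nfs ts → Nfs (t ∷ ts)

  data Neutral where
    var : Neutral (var {a = a})
    app : ∀ {f : ℛ as b} {ts : Tms Γ as} → Nfs ts → Neutral (app f ts)

  Nf-isLT : {t : Tm Γ (⊗ as)} → Nf t → isLT t ≡ true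
  Nf-isLT (tup _)     = refl
  Nf-isLT (letin n _) = Nf-isLT n

  idEnv-++ : ∀ Γ₁ Γ₂ → idEnv (Γ₁ ++ Γ₂) ≡ idEnv Γ₁ ++ idEnv Γ₂
  idEnv-++ []       Γ₂ = refl
  idEnv-++ (_ ∷ Γ₁) Γ₂ = cong (_ ∷_) (idEnv-++ Γ₁ Γ₂)

  idEnv-++₃ : ∀ Γ₁ Γ₂ Γ₃ →
    idEnv (Γ₁ ++ Γ₂ ++ Γ₃) ≡ idEnv Γ₁ ++ idEnv Γ₂ ++ idEnv Γ₃
  idEnv-++₃ Γ₁ Γ₂ Γ₃ =
    trans (idEnv-++ Γ₁ (Γ₂ ++ Γ₃)) (cong (idEnv Γ₁ ++_) (idEnv-++ Γ₂ Γ₃))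

  ctxOf-idEnv : ∀ Γ → ctxOf (idEnv Γ) ≡ Γ
  ctxOf-idEnv []      = refl
  ctxOf-idEnv (_ ∷ Γ) = cong (_ ∷_) (ctxOf-idEnv Γ)

  -- A neutral let argument reflects to one layer over the identity environment of the bound
  -- variables, so the body is again evaluated in an identity environment.
  Nf-code      : {t : Tm Γ a} → Nf t → normalForm t ≡ code t
  Nfs-codes    : {ts : Tms Γ as} → Nfs ts → quotes (evals ts (idEnv Γ)) ≡ codes ts
  Neutral-eval : {t : Tm Γ a} → Neutral t → eval t (idEnv Γ) ≡ reflect a (code t)
  Nf-code (ne n)  = cong quoteV (Neutral-eval n)
  Nf-code (tup n) = cong tup (Nfs-codes n)
  Nf-code (letin {as = as} {γ = γ} {δ = δ} {δ' = δ'} {s = s} {t = t} n m)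
    = begin
    normalForm (letin δ δ' s t)
      ≡⟨ cong quoteV (eval-letin s t (idEnv-typed δ) (idEnv-typed γ) (idEnv-++₃ δ γ δ')) ⟩
    quoteBind (eval t (idEnv γ))
      ≡⟨ cong quoteBind (Neutral-eval m) ⟩
    letin (ctxOf (idEnv δ) ++ []) (ctxOf (idEnv δ')) r (code t)
      ≡⟨ cong₂ (λ ε ε' → letin ε ε' r (code t))
           (trans (++-identityʳ _) (ctxOf-idEnv δ)) (ctxOf-idEnv δ') ⟩
    letin δ δ' r (code t)
      ≡⟨ cong (λ r → letin δ δ' r (code t))
           (trans (cong (λ ρ → quoteV (eval s ρ)) (sym (idEnv-++₃ δ as δ'))) (Nf-code n)) ⟩
    letin δ δ' (code s) (code t) ∎
    where
    open ≡-Reasoning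
    r = quoteV (eval s (idEnv δ ++ idEnv as ++ idEnv δ'))
    quoteBind : Val → Raw
    quoteBind v = quoteV (bind (ctxOf (idEnv δ)) (ctxOf (idEnv δ')) v
      (eval s (idEnv δ ++ comps (core v) ++ idEnv δ')))
  Nfs-codes [] = refl
  Nfs-codes (_∷_ {Γ₁ = Γ₁} {Γ₂ = Γ₂} {t = t} {ts = ts} n ns)
    rewrite idEnv-++ Γ₁ Γ₂
          | upto-all (idEnv-typed Γ₁) {idEnv Γ₂} | from-all (idEnv-typed Γ₁) {idEnv Γ₂} =
    cong₂ _∷_ (Nf-code n) (Nfs-codes ns)
  Neutral-eval {a = atom _} var = refl
  Neutral-eval {a = ⊗ _} var    = refl
  Neutral-eval {a = a} (app {f = f} ns) = cong (λ rs → reflect a (app f rs)) (Nfs-codes ns)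

  -- Injectivity of codes.

  tup-injective : ∀ {rs rs'} → Raw.tup rs ≡ tup rs' → rs ≡ rs'
  tup-injective refl = refl

  letin-injective : ∀ {δ δ' ε ε' r n r' n'} →
    Raw.letin δ δ' r n ≡ letin ε ε' r' n' → δ ≡ ε × δ' ≡ ε' × r ≡ r' × n ≡ n'
  letin-injective refl = refl , refl , refl , refl

  app-injective : ∀ {as b as' b'} {f : ℛ as b} {f' : ℛ as' b'} {rs rs'} →
    Raw.app f rs ≡ app f' rs' →
    _≡_ {A = Σ (List (Ty A)) λ as → Σ (Ty A) (ℛ as)} (as , b , f) (as' , b' , f')
    × rs ≡ rs'
  app-injective refl = refl , refl

  Term : Set
  Term = Σ Ctx λ Γ → Σ (Ty A) (Tm Γ)

  -- Contexts and types are part of the conclusion because subterms may a priori split the context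
  -- differently or have different types.
  code-injective : ∀ {Γ Γ' a a'} (s : Tm Γ a) (t : Tm Γ' a') →
    code s ≡ code t → _≡_ {A = Term} (Γ , a , s) (Γ' , a' , t)
  codes-injective : ∀ {Γ Γ' as as'} (ss : Tms Γ as) (ts : Tms Γ' as') →
    codes ss ≡ codes ts →
    _≡_ {A = Σ Ctx λ Γ → Σ (List (Ty A)) (Tms Γ)} (Γ , as , ss) (Γ' , as' , ts)
  code-injective var var refl = refl
  code-injective (tup ss) (tup ts) e
    with refl ← codes-injective ss ts (tup-injective e) = refl
  code-injective (letin δ δ' s t) (letin ε ε' s' t') e
    with letin-injective e
  ... | refl , refl , e₁ , e₂
    -- The argument comes first: it identifies the types of the bound variables, after which the
    -- contexts of the two bodies coincide.
    with refl ← code-injective t t' e₂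
    with refl ← code-injective s s' e₁ = refl
  code-injective (app f ss) (app f' ts) e with app-injective e
  ... | refl , e' with refl ← codes-injective ss ts e' = refl
  codes-injective [] [] refl = refl
  codes-injective (s ∷ ss) (t ∷ ts) e with ∷-injective e
  ... | e₁ , e₂ with refl ← code-injective s t e₁
                with refl ← codes-injective ss ts e₂ = refl

  Nf-unique : {s t : Tm Γ a} → Nf s → Nf t → normalForm s ≡ normalForm t → s ≡ t
  Nf-unique {s = s} {t} m n e
    with refl ← code-injective s t (trans (sym (Nf-code m)) (trans e (Nf-code n))) = refl

  -- Progress

  -- The steps that remain steps when placed as the argument of a let.
  data _⟶ᵢ_ : Tm Γ a → Tm Γ a → Set where
    β : {s t : Tm Γ a} → s ⟶β t → s ⟶ᵢ t
    η : (C : Hole Γh ah Γ a) → IsE C → NotHole C → {l r : Tm Γh ah} →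
        EtaRoot l r → plug C l ⟶ᵢ plug C r

  Reducible Reducibleᵢ : Tm Γ a → Set
  Reducible s  = ∃ λ t → s ⟶rep t
  Reducibleᵢ s = ∃ λ t → s ⟶ᵢ t

  ᵢ⇒rep : {s : Tm Γ a} → Reducibleᵢ s → Reducible s
  ᵢ⇒rep (t , β h)       = t , inj₁ h
  ᵢ⇒rep (_ , η C e n h) = _ , inj₂ (ctx C e h)

  body-reducible : ∀ δ δ' {s : Tm (δ ++ as ++ δ') b} (t : Tm γ (⊗ as)) →
    Reducible s → Reducibleᵢ (letin δ δ' s t)
  body-reducible δ δ' t (_ , inj₁ (ctx C h))   = _ , β (ctx (letBodyH δ δ' C t) h)
  body-reducible δ δ' t (_ , inj₂ (ctx C e h)) =
    _ , η (letBodyH δ δ' C t) (letBodyH e) tt h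

  arg-reducible : ∀ δ δ' (s : Tm (δ ++ as ++ δ') b) {t : Tm γ (⊗ as)} →
    Reducibleᵢ t → Reducibleᵢ (letin δ δ' s t)
  arg-reducible δ δ' s (_ , β (ctx C h))   = _ , β (ctx (letArgH δ δ' s C) h)
  arg-reducible δ δ' s (_ , η C e n h) = _ , η (letArgH δ δ' s C) (letArgH e n) tt h

  data SomeReducible : Tms Γ as → Set where
    at : (ts : Tms Γ₁ as) {s : Tm Γ a} (us : Tms Γ₂ bs) →
         Reducible s → SomeReducible (ts ++ₜ s ∷ us)

  SomeReducible-subst : ∀ {G D} (e : G ≡ D) {ts : Tms G as} →
    SomeReducible (subst (λ D → Tms D as) e ts) → SomeReducible ts
  SomeReducible-subst refl r = r

  later : (t : Tm Γ a) {ts : Tms Δ as} → SomeReducible ts → SomeReducible (t ∷ ts)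
  later {Γ = Γ} t (at {Γ₁ = Γ₁} {Γ = Γ'} {Γ₂ = Γ₂} ts us r) =
    SomeReducible-subst (sym (++-assoc Γ Γ₁ (Γ' ++ Γ₂))) (at (t ∷ ts) us r)

  tup-reducible : {ts : Tms Γ as} → SomeReducible ts → Reducibleᵢ (tup ts)
  tup-reducible (at ts us (_ , inj₁ (ctx C h)))   = _ , β (ctx (tupH ts C us) h)
  tup-reducible (at ts us (_ , inj₂ (ctx C e h))) = _ , η (tupH ts C us) (tupH e) tt h

  app-reducible : (f : ℛ as b) {ts : Tms Γ as} → SomeReducible ts → Reducibleᵢ (app f ts)
  app-reducible f (at ts us (_ , inj₁ (ctx C h)))   = _ , β (ctx (appH f ts C us) h)
  app-reducible f (at ts us (_ , inj₂ (ctx C e h))) = _ , η (appH f ts C us) (appH e) tt h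

  η-reducible : (s : Tm Γ (⊗ as)) → isLT s ≡ false → Reducible s
  η-reducible s e = _ , inj₂ (ctx [·] [·] (η s λ { (_ , L , ts , refl) →
    case trans (sym (isLT-plugL L (tup ts))) e of λ () }))

  β-reducible : ∀ δ δ' (s : Tm (δ ++ as ++ δ') b) {t : Tm γ (⊗ as)} →
    InLT t → Reducibleᵢ (letin δ δ' s t)
  β-reducible δ δ' s (_ , L , ts , refl) = _ , β (ctx [·] (β δ δ' s L ts))

  -- η is barred at the root of a let argument, so `progressArg` lets variables and applications of
  -- tensor type stand as neutral, and reports terms of LT, which make the enclosing let a β-redex.
  progress     : (t : Tm Γ a) → Reducible t ⊎ Nf t
  progressArg  : (t : Tm Γ (⊗ as)) → Reducibleᵢ t ⊎ InLT t ⊎ Neutral t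
  progressTms  : (ts : Tms Γ as) → SomeReducible ts ⊎ Nfs ts
  progress (var {a = atom _}) = inj₂ (ne var)
  progress (var {a = ⊗ _})    = inj₁ (η-reducible var refl)
  progress (tup ts) with progressTms ts
  ... | inj₁ r  = inj₁ (ᵢ⇒rep (tup-reducible r))
  ... | inj₂ ns = inj₂ (tup ns)
  progress (app {b = ⊗ _} f ts) = inj₁ (η-reducible (app f ts) refl)
  progress (app {b = atom _} f ts) with progressTms ts
  ... | inj₁ r  = inj₁ (ᵢ⇒rep (app-reducible f r))
  ... | inj₂ ns = inj₂ (ne (app ns))
  progress (letin δ δ' s t) with progressArg t
  ... | inj₁ r        = inj₁ (ᵢ⇒rep (arg-reducible δ δ' s r))
  ... | inj₂ (inj₁ l) = inj₁ (ᵢ⇒rep (β-reducible δ δ' s l))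
  ... | inj₂ (inj₂ m) with progress s
  ...   | inj₁ r = inj₁ (ᵢ⇒rep (body-reducible δ δ' t r))
  ...   | inj₂ n = inj₂ (letin n m)
  progressArg var      = inj₂ (inj₂ var)
  progressArg (tup ts) = inj₂ (inj₁ (_ , [·] , ts , refl))
  progressArg (app f ts) with progressTms ts
  ... | inj₁ r  = inj₁ (app-reducible f r)
  ... | inj₂ ns = inj₂ (inj₂ (app ns))
  progressArg (letin δ δ' s t) with progressArg t
  ... | inj₁ r        = inj₁ (arg-reducible δ δ' s r)
  ... | inj₂ (inj₁ l) = inj₁ (β-reducible δ δ' s l)
  ... | inj₂ (inj₂ m) with progress s
  ...   | inj₁ r = inj₁ (body-reducible δ δ' t r)
  -- A normal body of tensor type ends in a tuple under lets, so the whole argument lies in LT.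
  ...   | inj₂ n = inj₂ (inj₁ (InLT-isLT (letin δ δ' s t) (Nf-isLT n)))
  progressTms [] = inj₂ []
  progressTms (t ∷ ts) with progress t
  ... | inj₁ r = inj₁ (at [] ts r)
  ... | inj₂ n with progressTms ts
  ...   | inj₁ r  = inj₁ (later t r)
  ...   | inj₂ ns = inj₂ (n ∷ ns)

  -- Normalization and confluence.

  normalize : (t : Tm Γ a) → ∃ λ n → Star _⟶rep_ t n × Nf n
  normalize t = go t (⟶rep-sn t)
    where
    go : (t : Tm Γ a) → Acc (flip _⟶rep_) t → ∃ λ n → Star _⟶rep_ t n × Nf n
    go t (acc rec) with progress t
    ... | inj₂ nf      = t , done , nf
    ... | inj₁ (u , h) with go u (rec h)
    ...   | n , hs , nf = n , h ◅ hs , nf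

  -- Normal forms of the two reducts have the read-back of the common source, hence are equal by
  -- `Nf-unique`.
  ⟶rep-confluent : Confluent (_⟶rep_ {Γ} {a})
  ⟶rep-confluent {B = s} {t} hs ht with normalize s | normalize t
  ... | m , hm , nfm | n , hn , nfn
    with refl ← Nf-unique nfm nfn (trans (normalForm-↠ (hs ◅◅ hm)) (sym (normalForm-↠ (ht ◅◅ hn)))) =
    m , hm , hn

theorem3p10 : (A : Set) (ℛ : List (Ty A) → Ty A → Set) →
    ((Γ : Rep.Ctx A ℛ) (a : Ty A) →
    Confluent (Rep._⟶rep_ A ℛ {Γ} {a}))
    × ((Γ : Rep.Ctx A ℛ) (a : Ty A) →
    StronglyNormalizing (Rep._⟶rep_ A ℛ {Γ} {a}))
theorem3p10 A ℛ = (λ Γ a → ⟶rep-confluent) , (λ Γ a → ⟶rep-sn)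
  where open Normalization A ℛ
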